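{- Let $d$ be a nonnegative integer and let $A\in \mathrm{Mat}_{d+1}(\mathbb{R})$ be a nonnegative matrix (every entry is nonnegative). Then for all $0\le s,t\le d$ the following are equivalent. (i) The directed graph $\Gamma(A)$ is a bidirected path with endpoints $s,t$: $s\leftrightarrow *\leftrightarrow *\leftrightarrow\cdots\leftrightarrow *\leftrightarrow t$. (ii) The matrix $A$ is symmetrizable and multiplicity-free. Moreover, with $\{\theta_i\}_{i=0}^d$ an ordering of the eigenvalues of $A$ and $E_i$ the primitive idempotent of $A$ associated with $\theta_i$, the $(s,t)$-entry of $E_i$ times $$(\theta_i-\theta_0)\cdots(\theta_i-\theta_{i-1})(\theta_i-\theta_{i+1})\cdots(\theta_i-\theta_d)$$ is independent of $i$ for $0\le i\le d$, and this common value is nonzero.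
   Context: $\mathrm{Mat}_{d+1}(\mathbb{R})$ is the algebra of $(d+1)\times(d+1)$ real matrices, with rows and columns indexed by $0,1,\ldots,d$; it acts on $V=\mathbb{R}^{d+1}$ by left multiplication. $\Gamma(A)$ is the directed graph with vertex set $\{0,1,\ldots,d\}$, where $i\rightarrow j$ whenever $i\ne j$ and $A_{ij}\neq 0$. It is a bidirected path with endpoints $s,t$ whenever there is an ordering $x_0,x_1,\ldots,x_d$ of its vertices with $x_0=s$, $x_d=t$ such that $x_i\rightarrow x_j$ if and only if $|i-j|=1$ (for $d=0$: a single vertex with $s=t=0$). $A$ is symmetrizable whenever there exists an invertible diagonal matrix $\Delta\in\mathrm{Mat}_{d+1}(\mathbb{R})$ such that $\Delta A\Delta^{ -1}$ is symmetric. $A$ is multiplicity-free whenever $A$ is diagonalizable over $\mathbb{R}$ and all its eigenspaces have dimension $1$ (equivalently, the roots of its characteristic polynomial are real and mutually distinct). In this case let $\{\theta_i\}_{i=0}^d$ be an ordering of the eigenvalues of $A$ and let $V_i$ be the eigenspace for $\theta_i$; the primitive idempotent $E_i\in\mathrm{Mat}_{d+1}(\mathbb{R})$ of $A$ associated with $\theta_i$ is defined by $(E_i-I)V_i=0$ and $E_iV_j=0$ for $j\neq i$. Empty products equal $1$. -}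

module Defs where

open import Algebra.Bundles using (CommutativeRing)
open import Algebra.Structures using (IsCommutativeRing)
import Algebra.Properties.CommutativeMonoid.Sum as Sum
open import Data.Fin.Base using (Fin; zero; toℕ; fromℕ)
open import Data.Fin.Permutation using (Permutation′; _⟨$⟩ʳ_)
open import Data.Fin.Properties using (_≟_)
open import Data.Nat.Base using (ℕ; suc; ∣_-_∣)
open import Data.Product.Base using (∃; ∃-syntax; Σ-syntax; _×_)
open import Data.Vec.Functional using (Vector; removeAt)
open import Function.Bundles using (_⇔_)
open import Level using (0ℓ)
open import Relation.Binary.PropositionalEquality.Core using (_≡_; _≢_)
open import Relation.Binary.Structures using (IsDecTotalOrder)
open import Relation.Nullary.Decidable.Core using (yes; no)
open import Relation.Nullary.Negation.Core using (¬_)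
open import Relation.Unary using (Pred; _∈_)

-- The real numbers, given by their categorical axiomatisation: a
-- Dedekind-complete ordered field.  The axioms are the classical ones (the
-- order is decidable, suprema exist for arbitrary predicates), so that any two
-- models are isomorphic.  Equality is a setoid equality, because a
-- construction of ℝ from Cauchy sequences has no quotient type available.
record CompleteOrderedField : Set₁ where
  infix  4 _≈_ _≤_
  infixl 7 _*_
  infixl 6 _+_
  infix  8 -_
  field
    Carrier           : Set
    _≈_               : Carrier → Carrier → Set
    _≤_               : Carrier → Carrier → Set
    _+_               : Carrier → Carrier → Carrier
    _*_               : Carrier → Carrier → Carrier
    -_                : Carrier → Carrier
    0#                : Carrier
    1#                : Carrier
    isCommutativeRing : IsCommutativeRing _≈_ _+_ _*_ -_ 0# 1#
    0≉1               : ¬ (0# ≈ 1#)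
    inverse           : ∀ x → ¬ (x ≈ 0#) → ∃[ y ] x * y ≈ 1#
    isDecTotalOrder   : IsDecTotalOrder _≈_ _≤_
    +-monoˡ-≤         : ∀ z {x y} → x ≤ y → x + z ≤ y + z
    *-nonneg          : ∀ {x y} → 0# ≤ x → 0# ≤ y → 0# ≤ x * y

  UpperBound : Pred Carrier 0ℓ → Pred Carrier 0ℓ
  UpperBound S u = ∀ x → x ∈ S → x ≤ u

  field
    supremum : (S : Pred Carrier 0ℓ) → ∃ S → ∃ (UpperBound S) →
               ∃[ u ] UpperBound S u × (∀ v → UpperBound S v → u ≤ v)

  commutativeRing : CommutativeRing 0ℓ 0ℓ
  commutativeRing = record { isCommutativeRing = isCommutativeRing }

module LinearAlgebra (ℝ : CompleteOrderedField) where

  open CompleteOrderedField ℝ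
    using (Carrier; _≈_; _≤_; _+_; _*_; 0#; 1#; commutativeRing)
  open CommutativeRing commutativeRing
    using (_-_; +-commutativeMonoid; *-commutativeMonoid)
  open Sum +-commutativeMonoid using () renaming (sum to ∑)
  open Sum *-commutativeMonoid using () renaming (sum to ∏)

  private
    variable
      n : ℕ

  infix  4 _≈ᵥ_ _≈ₘ_
  infixl 7 _·_ _·ᵥ_ _∗ᵥ_

  _≈ᵥ_ : Vector Carrier n → Vector Carrier n → Set
  v ≈ᵥ w = ∀ i → v i ≈ w i

  0ᵥ : Vector Carrier n
  0ᵥ _ = 0#

  _∗ᵥ_ : Carrier → Vector Carrier n → Vector Carrier n
  (c ∗ᵥ v) i = c * v i

  Mat : ℕ → Set
  Mat n = Fin n → Fin n → Carrier

  _≈ₘ_ : Mat n → Mat n → Set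
  A ≈ₘ B = ∀ i j → A i j ≈ B i j

  I : Mat n
  I i j with i ≟ j
  ... | yes _ = 1#
  ... | no  _ = 0#

  _·_ : Mat n → Mat n → Mat n
  (A · B) i j = ∑ (λ k → A i k * B k j)

  _-ₘ_ : Mat n → Mat n → Mat n
  (A -ₘ B) i j = A i j - B i j

  _·ᵥ_ : Mat n → Vector Carrier n → Vector Carrier n
  (A ·ᵥ v) i = ∑ (λ k → A i k * v k)

  Nonnegative : Mat n → Set
  Nonnegative A = ∀ i j → 0# ≤ A i j

  Symmetric : Mat n → Set
  Symmetric A = ∀ i j → A i j ≈ A j i

  Diagonal : Mat n → Set
  Diagonal A = ∀ i j → i ≢ j → A i j ≈ 0#

  Inverses : Mat n → Mat n → Set
  Inverses P Q = P · Q ≈ₘ I × Q · P ≈ₘ I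

  Symmetrizable : Mat n → Set
  Symmetrizable A =
    ∃[ Δ ] ∃[ Δ⁻¹ ] Diagonal Δ × Inverses Δ Δ⁻¹ × Symmetric (Δ · A · Δ⁻¹)

  Diagonalizable : Mat n → Set
  Diagonalizable A =
    ∃[ P ] ∃[ P⁻¹ ] Inverses P P⁻¹ × Diagonal (P⁻¹ · A · P)

  Eigenspace : Mat n → Carrier → Pred (Vector Carrier n) 0ℓ
  Eigenspace A θ v = A ·ᵥ v ≈ᵥ θ ∗ᵥ v

  Eigenvalue : Mat n → Pred Carrier 0ℓ
  Eigenvalue A θ = ∃[ v ] v ∈ Eigenspace A θ × ¬ (v ≈ᵥ 0ᵥ)

  linearCombination : ∀ {m} → Vector Carrier m → Vector (Vector Carrier n) m →
                      Vector Carrier n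
  linearCombination c b i = ∑ (λ k → c k * b k i)

  record IsBasis {m} (W : Pred (Vector Carrier n) 0ℓ)
                 (b : Vector (Vector Carrier n) m) : Set where
    field
      members     : ∀ k → b k ∈ W
      independent : ∀ c → linearCombination c b ≈ᵥ 0ᵥ → ∀ k → c k ≈ 0#
      spanning    : ∀ w → w ∈ W → ∃[ c ] w ≈ᵥ linearCombination c b

  HasDimension : Pred (Vector Carrier n) 0ℓ → ℕ → Set
  HasDimension {n} W m = ∃[ b ] IsBasis {n} {m} W b

  MultiplicityFree : Mat n → Set
  MultiplicityFree A =
    Diagonalizable A × (∀ θ → Eigenvalue A θ → HasDimension (Eigenspace A θ) 1)

  record IsEigenvalueOrdering (A : Mat n) (θ : Vector Carrier n) : Set where
    field
      distinct   : ∀ i j → θ i ≈ θ j → i ≡ j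
      eigenvalue : ∀ i → Eigenvalue A (θ i)
      exhaustive : ∀ μ → Eigenvalue A μ → ∃[ i ] μ ≈ θ i

  IsPrimitiveIdempotent : Mat n → Vector Carrier n → Fin n → Mat n → Set
  IsPrimitiveIdempotent A θ i E =
    (∀ v → v ∈ Eigenspace A (θ i) → (E -ₘ I) ·ᵥ v ≈ᵥ 0ᵥ) ×
    (∀ j → j ≢ i → ∀ v → v ∈ Eigenspace A (θ j) → E ·ᵥ v ≈ᵥ 0ᵥ)

  -- ∏_{j ≠ i} (θ i - θ j)
  differenceProduct : ∀ {d} → Vector Carrier (suc d) → Fin (suc d) → Carrier
  differenceProduct θ i = ∏ (removeAt (λ j → θ i - θ j) i)

  Γ : Mat n → Fin n → Fin n → Set
  Γ A i j = i ≢ j × ¬ (A i j ≈ 0#)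

  IsBidirectedPath : ∀ {d} → (Fin (suc d) → Fin (suc d) → Set) →
                     Fin (suc d) → Fin (suc d) → Set
  IsBidirectedPath {d} _⟶_ s t =
    Σ[ x ∈ Permutation′ (suc d) ] x ⟨$⟩ʳ zero ≡ s × x ⟨$⟩ʳ fromℕ d ≡ t ×
      (∀ i j → ((x ⟨$⟩ʳ i) ⟶ (x ⟨$⟩ʳ j)) ⇔ (∣ toℕ i - toℕ j ∣ ≡ 1))

{-# OPTIONS --safe #-}

-- Write w i = (E i) s t.  Since A ^ k = ∑ θ i ^ k E i, the (s , t) entries of the
-- powers of A are the moments ∑ θ i ^ k w i, and the products
-- w i ∏_{j ≠ i} (θ i - θ j) all equal c if and only if these moments vanish for
-- k < d and equal c for k = d.  As A is nonnegative, this says that the distance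
-- from s to t is d, so that a shortest walk passes through every vertex exactly
-- once; symmetrizability makes its edges bidirected.
-- Conversely, relabelling along a path makes A tridiagonal with positive
-- off-diagonal entries.  The characteristic polynomials of its trailing blocks
-- satisfy a three-term recurrence whose signs force the roots to interlace, which
-- by the intermediate value theorem gives d + 1 distinct real eigenvalues.

module Submission where

open import Defs
open import Algebra.Bundles using (CommutativeRing; RawRing)
import Algebra.Properties.Ring
import Algebra.Properties.Semiring.Exp
import Algebra.Properties.Semiring.Mult.TCOptimised
import Algebra.Properties.Semiring.Sum
import Algebra.Solver.Ring as RingSolver
open import Algebra.Solver.Ring.AlmostCommutativeRing using (fromCommutativeRing; _-Raw-AlmostCommutative⟶_)
open import Data.Empty using (⊥-elim)
open import Data.Fin.Base using (Fin; zero; suc; toℕ; fromℕ; fromℕ<; punchIn; punchOut)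
open import Data.Fin.Permutation using (Permutation′; permutation; _⟨$⟩ʳ_; _⟨$⟩ˡ_; inverseʳ; inverseˡ)
import Data.Fin.Properties as Finₚ
open import Data.Integer.Base as ℤ using (ℤ; +_; -[1+_])
import Data.Integer.Properties as ℤₚ
open import Data.Maybe.Base using (Maybe; just; nothing)
open import Data.Nat.Base as ℕ using (ℕ; zero; suc; s≤s; ∣_-_∣)
import Data.Nat.Properties as ℕₚ
open import Data.Product.Base using (∃; ∃-syntax; Σ-syntax; _×_; _,_; proj₁; proj₂)
open import Data.Sum.Base using (_⊎_; inj₁; inj₂)
open import Data.Vec.Base as Vec using (Vec; []; _∷_; _∷ʳ_)
open import Data.Vec.Functional using (Vector; removeAt; insertAt)
import Data.Vec.Functional.Properties as Vecₚ
open import Data.Vec.Relation.Unary.All as All using (All; []; _∷_)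
import Data.Vec.Relation.Unary.All.Properties as Allₚ
open import Data.Vec.Relation.Unary.AllPairs using (AllPairs; []; _∷_)
open import Function.Base using (_∘_; id)
open import Function.Bundles using (_⇔_; Equivalence; mk⇔)
open import Level using (0ℓ)
open import Relation.Binary.PropositionalEquality.Core as ≡ using (_≡_; _≢_)
import Relation.Binary.Reasoning.Setoid
open import Relation.Binary.Structures using (IsDecTotalOrder)
open import Relation.Nullary.Decidable.Core using (yes; no; ¬?; decidable-stable)
open import Relation.Nullary.Negation.Core using (¬_)

-- The numbers 1 / ∏_{j ≠ i} (θ i - θ j) are the weights of the divided difference at the nodes θ,
-- which annihilates every power below the d-th and sends the d-th to 1; this is why constant
-- products amount to the stated moments. The equivalence is proved by removing one node at a time.
-- Nonnegativity rules out cancellation: an entry of a power of A is nonzero exactly when a walk of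
-- that length exists. The E i are known only through their action on eigenvectors, so the power
-- expansion is checked on an eigenbasis. In the other direction no spectral theorem is invoked.
-- Solving all rows but the first of (x - B) v = 0 from the bottom upwards gives polynomial entries,
-- and the defect of the first row is a positive multiple of the characteristic polynomial; hence no
-- determinants occur. Its roots come from sign changes, and the resulting eigenvectors, orthogonal
-- for a weighted form, make up an invertible matrix.

-- Arithmetic, signs and a ring solver for the real field.

module OrderedField (ℝ : CompleteOrderedField) where

  open CompleteOrderedField ℝ public
    using (Carrier; _≈_; _≤_; _+_; _*_; -_; 0#; 1#; 0≉1; inverse; supremum;
      commutativeRing; *-nonneg; UpperBound)
  open CommutativeRing commutativeRing public
    using (_-_; +-cong; +-congˡ; +-congʳ; *-cong; *-congˡ; *-congʳ; -‿cong; +-assoc; +-comm;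
      +-identityˡ; +-identityʳ; *-assoc; *-comm; *-identityˡ; *-identityʳ; zeroˡ; zeroʳ;
      -‿inverseˡ; -‿inverseʳ; setoid; semiring; ring)
    renaming (refl to ≈-refl; sym to ≈-sym; trans to ≈-trans; reflexive to ≈-reflexive)
  open IsDecTotalOrder (CompleteOrderedField.isDecTotalOrder ℝ) public
    using (_≟_; _≤?_; total; antisym)
    renaming (refl to ≤-refl; reflexive to ≤-reflexive; trans to ≤-trans;
      ≤-respˡ-≈ to ≤-respˡ; ≤-respʳ-≈ to ≤-respʳ)

  open Algebra.Properties.Ring ring using
    (-‿distribˡ-*; -‿distribʳ-*; -‿involutive; -0#≈0#; -‿+-comm)
  open Algebra.Properties.Semiring.Mult.TCOptimised semiring
    using (×-homo-+; ×1-homo-*; 1+×) renaming (_×_ to _⊗_)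
  module ≈-Reasoning = Relation.Binary.Reasoning.Setoid setoid
  open ≈-Reasoning

  private
    variable
      x y : Carrier

  -- The ring solver cancels only those coefficients that it can compare by computation,
  -- which those of an abstract field are not; hence integer coefficients.

  ⟦_⟧ℤ : ℤ → Carrier
  ⟦ + n ⟧ℤ      = n ⊗ 1#
  ⟦ -[1+ n ] ⟧ℤ = - (suc n ⊗ 1#)

  ⟦-⟧ℤ : ∀ i → ⟦ ℤ.- i ⟧ℤ ≈ - ⟦ i ⟧ℤ
  ⟦-⟧ℤ (+ zero)   = ≈-sym -0#≈0#
  ⟦-⟧ℤ (+ suc n)  = ≈-refl
  ⟦-⟧ℤ -[1+ n ]   = ≈-sym (-‿involutive _)

  ⟦⊖⟧ℤ : ∀ m n → ⟦ m ℤ.⊖ n ⟧ℤ ≈ m ⊗ 1# + - (n ⊗ 1#)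
  ⟦⊖⟧ℤ zero zero = ≈-sym (-‿inverseʳ 0#)
  ⟦⊖⟧ℤ zero (suc n) = ≈-sym (+-identityˡ _)
  ⟦⊖⟧ℤ (suc m) zero = ≈-sym (≈-trans (+-congˡ -0#≈0#) (+-identityʳ _))
  ⟦⊖⟧ℤ (suc m) (suc n) = begin
    ⟦ suc m ℤ.⊖ suc n ⟧ℤ                    ≡⟨ ≡.cong ⟦_⟧ℤ (ℤₚ.[1+m]⊖[1+n]≡m⊖n m n) ⟩
    ⟦ m ℤ.⊖ n ⟧ℤ                            ≈⟨ ⟦⊖⟧ℤ m n ⟩
    M + - N                                  ≈⟨ +-congʳ (+-identityʳ M) ⟨
    M + 0# + - N                             ≈⟨ +-congʳ (+-congˡ (-‿inverseʳ 1#)) ⟨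
    M + (1# + - 1#) + - N                    ≈⟨ +-congʳ (+-assoc M 1# (- 1#)) ⟨
    M + 1# + - 1# + - N                      ≈⟨ +-assoc _ _ _ ⟩
    M + 1# + (- 1# + - N)                    ≈⟨ +-cong (+-comm M 1#) (-‿+-comm 1# N) ⟩
    1# + M + - (1# + N)                      ≈⟨ +-cong (1+× m 1#) (-‿cong (1+× n 1#)) ⟨
    suc m ⊗ 1# + - (suc n ⊗ 1#)              ∎
    where
    M = m ⊗ 1#
    N = n ⊗ 1#

  ⟦+⟧ℤ : ∀ i j → ⟦ i ℤ.+ j ⟧ℤ ≈ ⟦ i ⟧ℤ + ⟦ j ⟧ℤ
  ⟦+⟧ℤ (+ m) (+ n) = ×-homo-+ 1# m n
  ⟦+⟧ℤ (+ m) -[1+ n ] = ⟦⊖⟧ℤ m (suc n)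
  ⟦+⟧ℤ -[1+ m ] (+ n) = ≈-trans (⟦⊖⟧ℤ n (suc m)) (+-comm _ _)
  ⟦+⟧ℤ i@(-[1+ m ]) j@(-[1+ n ]) = begin
    ⟦ i ℤ.+ j ⟧ℤ                           ≡⟨ ≡.cong ⟦_⟧ℤ (ℤₚ.neg-distrib-+ (+ suc m) (+ suc n)) ⟨
    ⟦ ℤ.- (+ suc m ℤ.+ + suc n) ⟧ℤ        ≈⟨ ⟦-⟧ℤ (+ suc m ℤ.+ + suc n) ⟩
    - ((suc m ℕ.+ suc n) ⊗ 1#)             ≈⟨ -‿cong (×-homo-+ 1# (suc m) (suc n)) ⟩
    - (suc m ⊗ 1# + suc n ⊗ 1#)            ≈⟨ -‿+-comm _ _ ⟨
    ⟦ i ⟧ℤ + ⟦ j ⟧ℤ                        ∎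

  ⟦*⟧ℤ : ∀ i j → ⟦ i ℤ.* j ⟧ℤ ≈ ⟦ i ⟧ℤ * ⟦ j ⟧ℤ
  ⟦*⟧ℤ i (+ n) = left i
    where
    pos : ∀ m → ⟦ + m ℤ.* + n ⟧ℤ ≈ m ⊗ 1# * (n ⊗ 1#)
    pos m = ≈-trans (≈-reflexive (≡.cong ⟦_⟧ℤ (≡.sym (ℤₚ.pos-* m n)))) (×1-homo-* m n)
    left : ∀ i → ⟦ i ℤ.* + n ⟧ℤ ≈ ⟦ i ⟧ℤ * (n ⊗ 1#)
    left (+ m) = pos m
    left -[1+ m ] = begin
      ⟦ -[1+ m ] ℤ.* + n ⟧ℤ          ≡⟨ ≡.cong ⟦_⟧ℤ (ℤₚ.neg-distribˡ-* (+ suc m) (+ n)) ⟨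
      ⟦ ℤ.- (+ suc m ℤ.* + n) ⟧ℤ    ≈⟨ ⟦-⟧ℤ (+ suc m ℤ.* + n) ⟩
      - ⟦ + suc m ℤ.* + n ⟧ℤ         ≈⟨ -‿cong (pos (suc m)) ⟩
      - (suc m ⊗ 1# * (n ⊗ 1#))      ≈⟨ -‿distribˡ-* _ _ ⟩
      - (suc m ⊗ 1#) * (n ⊗ 1#)      ∎
  ⟦*⟧ℤ i -[1+ n ] = begin
    ⟦ i ℤ.* -[1+ n ] ⟧ℤ              ≡⟨ ≡.cong ⟦_⟧ℤ (ℤₚ.neg-distribʳ-* i (+ suc n)) ⟨
    ⟦ ℤ.- (i ℤ.* + suc n) ⟧ℤ        ≈⟨ ⟦-⟧ℤ (i ℤ.* + suc n) ⟩
    - ⟦ i ℤ.* + suc n ⟧ℤ             ≈⟨ -‿cong (⟦*⟧ℤ i (+ suc n)) ⟩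
    - (⟦ i ⟧ℤ * (suc n ⊗ 1#))        ≈⟨ -‿distribʳ-* _ _ ⟩
    ⟦ i ⟧ℤ * - (suc n ⊗ 1#)          ∎

  ℤ-rawRing : RawRing 0ℓ 0ℓ
  ℤ-rawRing = record { Carrier = ℤ ; _≈_ = _≡_ ; _+_ = ℤ._+_ ; _*_ = ℤ._*_ ; -_ = ℤ.-_ ; 0# =
    + 0 ; 1# = + 1 }

  ℤ-morphism : ℤ-rawRing -Raw-AlmostCommutative⟶ fromCommutativeRing commutativeRing
  ℤ-morphism = record
    { ⟦_⟧ = ⟦_⟧ℤ ; +-homo = ⟦+⟧ℤ ; *-homo = ⟦*⟧ℤ ; -‿homo = ⟦-⟧ℤ ; 0-homo = ≈-refl ; 1-homo =
        ≈-refl }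

  ℤ-weaklyDec : ∀ i j → Maybe (⟦ i ⟧ℤ ≈ ⟦ j ⟧ℤ)
  ℤ-weaklyDec i j with i ℤₚ.≟ j
  ... | yes i≡j = just (≈-reflexive (≡.cong ⟦_⟧ℤ i≡j))
  ... | no  _   = nothing

  open RingSolver ℤ-rawRing (fromCommutativeRing commutativeRing) ℤ-morphism ℤ-weaklyDec public
    using (Polynomial; con; _:+_; _:*_; :-_; _:-_; _:=_; solve)

  :0 :1 : ∀ {n} → Polynomial n
  :0 = con (+ 0)
  :1 = con (+ 1)

  -- For a decidable total order this negation amounts to being nonnegative and nonzero; every
  -- strict inequality is reduced to it.
  Pos : Carrier → Set
  Pos x = ¬ (x ≤ 0#)

  infix 4 _<_
  _<_ : Carrier → Carrier → Set
  x < y = Pos (y - x)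

  nonneg-resp : x ≈ y → 0# ≤ x → 0# ≤ y
  nonneg-resp x≈y = ≤-respʳ x≈y

  pos-resp : x ≈ y → Pos x → Pos y
  pos-resp x≈y px y≤0 = px (≤-respˡ (≈-sym x≈y) y≤0)

  pos⇒nonneg : Pos x → 0# ≤ x
  pos⇒nonneg {x} px with total 0# x
  ... | inj₁ 0≤x = 0≤x
  ... | inj₂ x≤0 = ⊥-elim (px x≤0)

  pos⇒≉0 : Pos x → ¬ (x ≈ 0#)
  pos⇒≉0 px x≈0 = px (≤-reflexive x≈0)

  nonneg∧≉0⇒pos : 0# ≤ x → ¬ (x ≈ 0#) → Pos x
  nonneg∧≉0⇒pos 0≤x x≉0 x≤0 = x≉0 (antisym x≤0 0≤x)

  ≤⇒nonneg : x ≤ y → 0# ≤ y - x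
  ≤⇒nonneg {x} {y} x≤y = ≤-respˡ (-‿inverseʳ x) (CompleteOrderedField.+-monoˡ-≤ ℝ (- x) x≤y)

  nonneg⇒≤ : 0# ≤ y - x → x ≤ y
  nonneg⇒≤ {y} {x} p =
    ≤-respˡ (+-identityˡ x) (≤-respʳ (solve 2 (λ x y → y :- x :+ x := y) ≈-refl x y)
      (CompleteOrderedField.+-monoˡ-≤ ℝ x p))

  ≰⇒> : ¬ (x ≤ y) → y < x
  ≰⇒> {x} {y} x≰y x-y≤0 =
    x≰y (nonneg⇒≤ (nonneg-resp (solve 2 (λ x y → :0 :- (x :- y) := y :- x) ≈-refl x y)
      (≤⇒nonneg x-y≤0)))

  <⇒≱ : x < y → ¬ (y ≤ x)
  <⇒≱ {x} {y} x<y y≤x =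
    x<y (nonneg⇒≤ (nonneg-resp (solve 2 (λ x y → x :- y := :0 :- (y :- x)) ≈-refl x y)
      (≤⇒nonneg y≤x)))

  <⇒≤ : x < y → x ≤ y
  <⇒≤ x<y = nonneg⇒≤ (pos⇒nonneg x<y)

  nonneg-+ : 0# ≤ x → 0# ≤ y → 0# ≤ x + y
  nonneg-+ {x} {y} 0≤x 0≤y =
    ≤-trans 0≤y (nonneg⇒≤ (nonneg-resp (solve 2 (λ x y → x := x :+ y :- y) ≈-refl x y) 0≤x))

  pos-+ˡ : Pos x → 0# ≤ y → Pos (x + y)
  pos-+ˡ {x} {y} px 0≤y x+y≤0 =
    px (≤-trans (nonneg⇒≤ (nonneg-resp (solve 2 (λ x y → y := x :+ y :- x) ≈-refl x y) 0≤y)) x+y≤0)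

  pos-+ʳ : 0# ≤ x → Pos y → Pos (x + y)
  pos-+ʳ 0≤x py = pos-resp (+-comm _ _) (pos-+ˡ py 0≤x)

  pos-+ : Pos x → Pos y → Pos (x + y)
  pos-+ px py = pos-+ˡ px (pos⇒nonneg py)

  x*y≈0⇒y≈0 : ¬ (x ≈ 0#) → x * y ≈ 0# → y ≈ 0#
  x*y≈0⇒y≈0 {x} {y} x≉0 xy≈0 = let (i , xi≈1) = inverse x x≉0 in begin
    y            ≈⟨ *-identityˡ y ⟨
    1# * y       ≈⟨ *-congʳ xi≈1 ⟨
    x * i * y    ≈⟨ solve 3 (λ x i y → x :* i :* y := i :* (x :* y)) ≈-refl x i y ⟩
    i * (x * y)  ≈⟨ *-congˡ xy≈0 ⟩
    i * 0#       ≈⟨ zeroʳ i ⟩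
    0#           ∎

  *-≉0 : ¬ (x ≈ 0#) → ¬ (y ≈ 0#) → ¬ (x * y ≈ 0#)
  *-≉0 x≉0 y≉0 xy≈0 = y≉0 (x*y≈0⇒y≈0 x≉0 xy≈0)

  pos-* : Pos x → Pos y → Pos (x * y)
  pos-* px py = nonneg∧≉0⇒pos (*-nonneg (pos⇒nonneg px) (pos⇒nonneg py))
    (*-≉0 (pos⇒≉0 px) (pos⇒≉0 py))

  data Sign (x : Carrier) : Set where
    positive : Pos x → Sign x
    negative : Pos (- x) → Sign x
    is-zero  : x ≈ 0# → Sign x

  sign : ∀ x → Sign x
  sign x with x ≤? 0# | 0# ≤? x
  ... | no  px  | _       = positive px
  ... | yes x≤0 | no  0≰x = negative (pos-resp (+-identityˡ (- x)) (≰⇒> 0≰x))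
  ... | yes x≤0 | yes 0≤x = is-zero (antisym x≤0 0≤x)

  ≉0⇒pos-square : ¬ (x ≈ 0#) → Pos (x * x)
  ≉0⇒pos-square {x} x≉0 with sign x
  ... | positive px  = pos-* px px
  ... | negative p-x = pos-resp (solve 1 (λ x → (:- x) :* (:- x) := x :* x) ≈-refl x)
    (pos-* p-x p-x)
  ... | is-zero x≈0  = ⊥-elim (x≉0 x≈0)

  square-nonneg : ∀ x → 0# ≤ x * x
  square-nonneg x with x ≟ 0#
  ... | yes x≈0 = ≤-reflexive (≈-sym (≈-trans (*-congʳ x≈0) (zeroˡ x)))
  ... | no  x≉0 = pos⇒nonneg (≉0⇒pos-square x≉0)

  1≉0 : ¬ (1# ≈ 0#)
  1≉0 1≈0 = 0≉1 (≈-sym 1≈0)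

  1-pos : Pos 1#
  1-pos = pos-resp (*-identityˡ 1#) (≉0⇒pos-square 1≉0)

  abstract
    -- The inverse y equals x y², a product of positive factors.
    pos-inverse : Pos x → ∃[ y ] x * y ≈ 1# × Pos y
    pos-inverse {x} px with inverse x (pos⇒≉0 px)
    ... | y , xy≈1 = y , xy≈1 , pos-resp
      (≈-trans (solve 2 (λ x y → x :* (y :* y) := x :* y :* y) ≈-refl x y)
               (≈-trans (*-congʳ xy≈1) (*-identityˡ y)))
      (pos-* px (≉0⇒pos-square λ y≈0 → 1≉0
        (≈-trans (≈-sym xy≈1) (≈-trans (*-congˡ y≈0) (zeroʳ x)))))

  x-y≈0⇒x≈y : x - y ≈ 0# → x ≈ y
  x-y≈0⇒x≈y {x} {y} x-y≈0 = begin
    x          ≈⟨ solve 2 (λ x y → x := x :- y :+ y) ≈-refl x y ⟩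
    x - y + y  ≈⟨ +-congʳ x-y≈0 ⟩
    0# + y     ≈⟨ +-identityˡ y ⟩
    y          ∎

  x≈y⇒x-y≈0 : x ≈ y → x - y ≈ 0#
  x≈y⇒x-y≈0 {x} {y} x≈y = ≈-trans (+-congʳ x≈y) (-‿inverseʳ y)

-- Polynomial functions: division, continuity, intermediate values, growth.

module PolynomialFunctions (ℝ : CompleteOrderedField) where

  open OrderedField ℝ
  open ≈-Reasoning

  -- Polynomial functions of degree at most k whose coefficient of degree k is c,
  -- defined by the property that they can be divided by every x - r.
  data Poly : ℕ → Carrier → (Carrier → Carrier) → Set where
    constant  : ∀ {c f} → (∀ x → f x ≈ c) → Poly zero c f
    divisible : ∀ {k c f} → (∀ r → ∃[ g ] ∃[ e ] Poly k c g × (∀ x → f x ≈ (x - r) * g x + e)) →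
      Poly (suc k) c f

  private
    variable
      k : ℕ
      a b c c′ x y : Carrier
      f g : Carrier → Carrier

  poly-resp : (∀ x → f x ≈ g x) → Poly k c f → Poly k c g
  poly-resp f≈g (constant p) = constant λ x → ≈-trans (≈-sym (f≈g x)) (p x)
  poly-resp f≈g (divisible p) = divisible λ r → let (h , e , ph , f≈) = p r in
    h , e , ph , λ x → ≈-trans (≈-sym (f≈g x)) (f≈ x)

  poly-coefficient : c ≈ c′ → Poly k c f → Poly k c′ f
  poly-coefficient c≈c′ (constant p) = constant λ x → ≈-trans (p x) c≈c′
  poly-coefficient c≈c′ (divisible p) = divisible λ r → let (h , e , ph , f≈) = p r in
    h , e , poly-coefficient c≈c′ ph , f≈

  -- Only the bound on the degree rises, with formal leading coefficient zero; this allows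
  -- polynomials of different degrees to be added.
  poly-lift : Poly k c f → Poly (suc k) 0# f
  poly-lift {c = c} (constant p) = divisible λ r → (λ _ → 0#) , c , constant (λ _ → ≈-refl) , λ x →
    ≈-trans (p x) (solve 3 (λ c x r → c := (x :- r) :* :0 :+ c) ≈-refl c x r)
  poly-lift (divisible p) = divisible λ r → let (h , e , ph , f≈) = p r in h , e , poly-lift ph , f≈

  poly-const : ∀ k e → Poly (suc k) 0# (λ _ → e)
  poly-const zero    e = poly-lift (constant λ _ → ≈-refl)
  poly-const (suc k) e = poly-lift (poly-const k e)

  poly-+ : Poly k c f → Poly k c′ g → Poly k (c + c′) (λ x → f x + g x)
  poly-+ (constant pf) (constant pg) = constant λ x → +-cong (pf x) (pg x)
  poly-+ (divisible pf) (divisible pg) = divisible λ r →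
    let (f′ , e , pf′ , f≈) = pf r
        (g′ , d , pg′ , g≈) = pg r
    in (λ x → f′ x + g′ x) , e + d , poly-+ pf′ pg′ , λ x → ≈-trans (+-cong (f≈ x) (g≈ x))
       (solve 5 (λ y f e g d → y :* f :+ e :+ (y :* g :+ d) := y :* (f :+ g) :+ (e :+ d)) ≈-refl
         (x - r) (f′ x) e (g′ x) d)

  poly-scale : ∀ a → Poly k c f → Poly k (a * c) (λ x → a * f x)
  poly-scale a (constant p) = constant λ x → *-congˡ (p x)
  poly-scale a (divisible p) = divisible λ r → let (g , e , pg , f≈) = p r in
    (λ x → a * g x) , a * e , poly-scale a pg , λ x → ≈-trans (*-congˡ (f≈ x))
      (solve 4 (λ a y g e → a :* (y :* g :+ e) := y :* (a :* g) :+ a :* e) ≈-refl a (x - r) (g x) e)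

  poly-shift : ∀ a → Poly k c f → Poly (suc k) c (λ x → (x - a) * f x)
  poly-shift {c = c} a (constant p) = divisible λ r → (λ _ → c) , (r - a) * c , constant
    (λ _ → ≈-refl) , λ x → ≈-trans (*-congˡ (p x))
    (solve 4 (λ x a c r → (x :- a) :* c := (x :- r) :* c :+ (r :- a) :* c) ≈-refl x a c r)
  poly-shift {suc k} {c} a (divisible p) = divisible λ r → let (g , e , pg , f≈) = p r in
    -- Splitting x - a as (x - r) + (r - a) in front of the old remainder keeps the new remainder
    -- constant.
    (λ x → (x - a) * g x + e) , (r - a) * e ,
    poly-coefficient (+-identityʳ c) (poly-+ (poly-shift a pg) (poly-const k e)) , λ x → ≈-trans
      (*-congˡ (f≈ x))
      (solve 5 (λ x a r g e → (x :- a) :* ((x :- r) :* g :+ e) := (x :- r) :*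
        ((x :- a) :* g :+ e) :+ (r :- a) :* e)
        ≈-refl x a r (g x) e)

  poly-translate : ∀ a → Poly k c f → Poly k c (λ x → f (a + x))
  poly-translate a (constant p) = constant λ x → p (a + x)
  poly-translate a (divisible p) = divisible λ r → let (g , e , pg , f≈) = p (a + r) in
    (λ x → g (a + x)) , e , poly-translate a pg , λ x → ≈-trans (f≈ (a + x))
      (+-congʳ (*-congʳ (solve 3 (λ a x r → a :+ x :- (a :+ r) := x :- r) ≈-refl a x r)))

  -- Division at y leaves the factor x - y, which vanishes. An arbitrary function need not respect
  -- the setoid equality, so this must be derived.
  poly-cong : Poly k c f → x ≈ y → f x ≈ f y
  poly-cong (constant p) x≈y = ≈-trans (p _) (≈-sym (p _))
  poly-cong {x = x} {y} (divisible p) x≈y = let (g , e , pg , f≈) = p y in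
    ≈-trans (f≈ x) (≈-trans (+-congʳ (≈-trans (*-congʳ (x≈y⇒x-y≈0 x≈y))
      (solve 3 (λ y g h → :0 :* g := (y :- y) :* h) ≈-refl y (g x) (g y)))) (≈-sym (f≈ y)))

  poly-divide : Poly (suc k) c f → ∀ r → ∃[ g ] Poly k c g × (∀ x → f x ≈ (x - r) * g x + f r)
  poly-divide (divisible p) r = let (g , e , pg , f≈) = p r in g , pg , λ x →
    ≈-trans (f≈ x) (+-congˡ (≈-sym (≈-trans (f≈ r)
      (solve 3 (λ r g e → (r :- r) :* g :+ e := e) ≈-refl r (g r) e))))

  sgn : ℕ → Carrier
  sgn zero    = 1#
  sgn (suc k) = - sgn k

  sgn-square : ∀ k → sgn k * sgn k ≈ 1#
  sgn-square zero    = *-identityˡ 1#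
  sgn-square (suc k) = ≈-trans (solve 1 (λ s → (:- s) :* (:- s) := s :* s) ≈-refl (sgn k))
    (sgn-square k)

  -- Division at - r turns each linear factor into its negative, hence one sign per degree. This
  -- gives access to the behaviour at minus infinity.
  poly-reflect : Poly k c f → Poly k (sgn k * c) (λ x → f (- x))
  poly-reflect {c = c} (constant p) = constant λ x → ≈-trans (p (- x)) (≈-sym (*-identityˡ c))
  poly-reflect {suc k} {c} (divisible p) = divisible λ r → let (g , e , pg , f≈) = p (- r) in
    (λ x → - 1# * g (- x)) , e ,
    poly-coefficient (solve 2 (λ s c → :- :1 :* (s :* c) := (:- s) :* c) ≈-refl (sgn k) c)
      (poly-scale (- 1#) (poly-reflect pg)) ,
    λ x → ≈-trans (f≈ (- x)) (+-congʳ
      (solve 3 (λ x r g → (:- x :- (:- r)) :* g := (x :- r) :* (:- :1 :* g)) ≈-refl x r (g (- x))))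

  -- The inequality |y| ≤ M, split in two so that no absolute value is needed.
  Within : Carrier → Carrier → Set
  Within M y = 0# ≤ M - y × 0# ≤ M + y

  within-+ : Within a x → Within b y → Within (a + b) (x + y)
  within-+ {a} {x} {b} {y} (p , q) (p′ , q′) =
    nonneg-resp (solve 4 (λ a x b y → a :- x :+ (b :- y) := a :+ b :- (x :+ y)) ≈-refl a x b y)
      (nonneg-+ p p′) ,
    nonneg-resp (solve 4 (λ a x b y → a :+ x :+ (b :+ y) := a :+ b :+ (x :+ y)) ≈-refl a x b y)
      (nonneg-+ q q′)

  within-resp : x ≈ y → Within a x → Within a y
  within-resp x≈y (p , q) = nonneg-resp (+-congˡ (-‿cong x≈y)) p , nonneg-resp (+-congˡ x≈y) q

  nonneg-half : 0# ≤ x + x → 0# ≤ x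
  nonneg-half {x} 0≤2x with sign x
  ... | positive px  = pos⇒nonneg px
  ... | is-zero x≈0  = ≤-reflexive (≈-sym x≈0)
  ... | negative p-x = ⊥-elim (pos-+ p-x p-x (nonneg⇒≤ (nonneg-resp
    (solve 1 (λ x → x :+ x := :0 :- (:- x :+ (:- x))) ≈-refl x) 0≤2x)))

  within-nonneg : Within a x → 0# ≤ a
  within-nonneg {a} {x} (p , q) =
    nonneg-half (nonneg-resp (solve 2 (λ a x → a :- x :+ (a :+ x) := a :+ a) ≈-refl a x)
      (nonneg-+ p q))

  -- The identity 2 (ab - xy) = (a - x)(b + y) + (a + x)(b - y) and its mirror image for ab + xy
  -- avoid distinguishing signs.
  within-* : Within a x → Within b y → Within (a * b) (x * y)
  within-* {a} {x} {b} {y} (p , q) (p′ , q′) =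
    nonneg-half (nonneg-resp
      (solve 4 (λ a x b y → (a :- x) :* (b :+ y) :+ (a :+ x) :* (b :- y) := (a :* b :- x :* y) :+
        (a :* b :- x :* y)) ≈-refl a x b y)
      (nonneg-+ (*-nonneg p q′) (*-nonneg q p′))) ,
    nonneg-half (nonneg-resp
      (solve 4 (λ a x b y → (a :- x) :* (b :- y) :+ (a :+ x) :* (b :+ y) := (a :* b :+ x :* y) :+
        (a :* b :+ x :* y)) ≈-refl a x b y)
      (nonneg-+ (*-nonneg p p′) (*-nonneg q q′)))

  within-some : ∀ x → ∃[ M ] Within M x
  within-some x with total 0# x
  ... | inj₁ 0≤x = x , ≤-reflexive (≈-sym (-‿inverseʳ x)) , nonneg-+ 0≤x 0≤x
  ... | inj₂ x≤0 = - x , nonneg-+ 0≤-x 0≤-x , ≤-reflexive (≈-sym (-‿inverseˡ x))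
    where
    0≤-x : 0# ≤ - x
    0≤-x = nonneg-resp (+-identityˡ (- x)) (≤⇒nonneg x≤0)

  poly-bounded : Poly k c f → ∀ R → ∃[ M ] (∀ x → Within R x → Within M (f x))
  poly-bounded {c = c} (constant p) R =
    let (M , w) = within-some c in M , λ x _ → within-resp (≈-sym (p x)) w
  poly-bounded (divisible p) R =
    let (g , e , pg , f≈) = p 0#
        (M , w)  = poly-bounded pg R
        (M′ , w′) = within-some e
    in R * M + M′ , λ x wx → within-resp (≈-sym (f≈ x))
         (within-+ (within-* (within-resp (solve 1 (λ x → x := x :- :0) ≈-refl x) wx) (w x wx)) w′)

  abstract
    -- Division at z gives f (z + y) = f z + y g (z + y) with |g (z + y)| ≤ M for |y| ≤ 1.
    -- Continuity is used only in this form.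
    poly-locally-positive : Poly k c f → ∀ z → Pos (f z) →
                            ∃[ δ ] Pos δ × (∀ y → Within δ y → Pos (f (z + y)))
    poly-locally-positive (constant p) z fz>0 =
      1# , 1-pos , λ y _ → pos-resp (≈-trans (p z) (≈-sym (p (z + y)))) fz>0
    poly-locally-positive {f = f} p@(divisible _) z fz>0 =
      let (g , pg , f≈)  = poly-divide p z
          (M , bound)    = poly-bounded (poly-translate z pg) 1#
          0≤1            = pos⇒nonneg 1-pos
          e              = f z
          0≤M            = within-nonneg
            (bound 0# (nonneg-resp (solve 0 (:1 := :1 :- :0) ≈-refl) 0≤1 , nonneg-resp
            (≈-sym (+-identityʳ 1#)) 0≤1))
          (i , i≈ , i>0) = pos-inverse (pos-+ˡ fz>0 0≤M)
          δ              = e * i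
          δ>0            = pos-* fz>0 i>0
          -- δ = e / (e + M) makes both δ ≤ 1 and e - δ M = δ e > 0.
          1-δ            = nonneg-resp {M * i} {1# - δ}
            (≈-trans (solve 3 (λ e M i → M :* i := (e :+ M) :* i :- e :* i) ≈-refl e M i)
              (+-congʳ i≈))
            (*-nonneg 0≤M (pos⇒nonneg i>0))
      in δ , δ>0 , λ y (δ-y , δ+y) →
        let within-1 = nonneg-resp (solve 2 (λ d y → :1 :- d :+ (d :- y) := :1 :- y) ≈-refl δ y)
              (nonneg-+ 1-δ δ-y) ,
                       nonneg-resp (solve 2 (λ d y → :1 :- d :+ (d :+ y) := :1 :+ y) ≈-refl δ y)
                         (nonneg-+ 1-δ δ+y)
            (_ , lower) = within-* {δ} {y} (δ-y , δ+y) (bound y within-1)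
        -- As δ (e + M) = e, the value e + y g splits into the positive δ e and the nonnegative δ M
        -- + y g.
        in pos-resp
          (begin
            δ * e + (δ * M + y * g (z + y))
              ≈⟨ solve 6 (λ e M i y g z → e :* i :* e :+ (e :* i :* M :+ y :* g) := y :* g :+ e :*
              ((e :+ M) :* i)) ≈-refl e M i y (g (z + y)) z ⟩
            y * g (z + y) + e * ((e + M) * i)      ≈⟨ +-congˡ (*-congˡ i≈) ⟩
            y * g (z + y) + e * 1#
              ≈⟨ solve 4 (λ y g e z → y :* g :+ e :* :1 := (z :+ y :- z) :* g :+ e) ≈-refl y
              (g (z + y)) e z ⟩
            (z + y - z) * g (z + y) + e            ≈⟨ f≈ (z + y) ⟨
            f (z + y)                              ∎)
          (pos-+ˡ (pos-* δ>0 fz>0) lower)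

  Nonpositive : (Carrier → Carrier) → Carrier → Carrier → Carrier → Set
  Nonpositive f u v x = u ≤ x × x ≤ v × f x ≤ 0#

  ≤∧≉⇒< : x ≤ y → ¬ (x ≈ y) → x < y
  ≤∧≉⇒< x≤y x≉y = nonneg∧≉0⇒pos (≤⇒nonneg x≤y) λ y-x≈0 → x≉y (≈-sym (x-y≈0⇒x≈y y-x≈0))

  pos-neg⇒≤0 : Pos (- x) → x ≤ 0#
  pos-neg⇒≤0 x<0 = nonneg⇒≤ (nonneg-resp (≈-sym (+-identityˡ _)) (pos⇒nonneg x<0))

  -- If f were positive at z, it would be so on [z - δ , z], and z - δ would be a smaller upper
  -- bound.
  sup-nonpositive-≯0 : Poly k c f → ∀ u v z → UpperBound (Nonpositive f u v) z →
                       (∀ w → UpperBound (Nonpositive f u v) w → z ≤ w) → ¬ Pos (f z)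
  sup-nonpositive-≯0 {f = f} p u v z z-upper z-least fz>0 with poly-locally-positive p z fz>0
  ... | δ , δ>0 , near = δ>0 (nonneg⇒≤ (nonneg-resp
            (solve 2 (λ z d → z :- d :- z := :0 :- d) ≈-refl z δ)
              (≤⇒nonneg (z-least (z - δ) upper))))
    where
    upper : UpperBound (Nonpositive f u v) (z - δ)
    upper x (u≤x , x≤v , fx≤0) with x ≤? z - δ
    ... | yes x≤ = x≤
    ... | no  x≰ = ⊥-elim (pos-resp (poly-cong p (solve 2 (λ z x → z :+ (x :- z) := x) ≈-refl z x))
      (near (x - z)
        ( nonneg-resp (solve 3 (λ d x z → d :+ (z :- x) := d :- (x :- z)) ≈-refl δ x z)
            (nonneg-+ (pos⇒nonneg δ>0) (≤⇒nonneg (z-upper x (u≤x , x≤v , fx≤0))))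
        , nonneg-resp (solve 3 (λ d x z → x :- (z :- d) := d :+ (x :- z)) ≈-refl δ x z)
            (pos⇒nonneg (≰⇒> x≰))))
      fx≤0)

  -- If f were negative at z, then z < v and f would stay negative just to the right; moving by the
  -- smaller of δ and v - z finds a member of the set beyond its upper bound.
  sup-nonpositive-≮0 : Poly k c f → ∀ u v z → UpperBound (Nonpositive f u v) z →
                       u ≤ z → z ≤ v → Pos (f v) → ¬ Pos (- f z)
  sup-nonpositive-≮0 {f = f} p u v z z-upper u≤z z≤v fv>0 fz<0
    with poly-locally-positive (poly-scale (- 1#) p) z
      (pos-resp (solve 1 (λ x → :- x := :- :1 :* x) ≈-refl (f z)) fz<0)
  ... | δ , δ>0 , near = step (total δ (v - z))
    where
    z<v : z < v
    z<v = ≤∧≉⇒< z≤v λ z≈v → pos-resp (poly-cong p (≈-sym z≈v)) fv>0 (pos-neg⇒≤0 fz<0)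
    exceed : ∀ y → Pos y → y ≤ δ → ¬ (y ≤ v - z)
    exceed y y>0 y≤δ y≤v-z = <⇒≱ (pos-resp (solve 2 (λ z y → y := z :+ y :- z) ≈-refl z y) y>0)
      (z-upper (z + y)
      ( nonneg⇒≤ (nonneg-resp (solve 3 (λ z u y → z :- u :+ y := z :+ y :- u) ≈-refl z u y)
          (nonneg-+ (≤⇒nonneg u≤z) (pos⇒nonneg y>0)))
      , nonneg⇒≤ (nonneg-resp (solve 3 (λ v z y → v :- z :- y := v :- (z :+ y)) ≈-refl v z y)
          (≤⇒nonneg y≤v-z))
      , nonneg⇒≤ (nonneg-resp (solve 1 (λ w → :- :1 :* w := :0 :- w) ≈-refl (f (z + y)))
          (pos⇒nonneg (near y (≤⇒nonneg y≤δ , nonneg-+ (pos⇒nonneg δ>0) (pos⇒nonneg y>0)))))))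
    step : ¬ (δ ≤ v - z ⊎ v - z ≤ δ)
    step (inj₁ δ≤) = exceed δ δ>0 ≤-refl δ≤
    step (inj₂ ≤δ) = exceed (v - z) z<v ≤δ ≤-refl

  abstract
    -- The zero is the supremum of the points of [u , v] where f is nonpositive; it is no endpoint
    -- because f is nonzero at both.
    intermediate-value : Poly k c f → ∀ u v → u < v → Pos (- f u) → Pos (f v) →
                         ∃[ z ] u < z × z < v × f z ≈ 0#
    intermediate-value {f = f} p u v u<v fu<0 fv>0
      with supremum (Nonpositive f u v) (u , ≤-refl , <⇒≤ u<v , pos-neg⇒≤0 fu<0)
        (v , λ x x∈S → proj₁ (proj₂ x∈S))
    ... | z , z-upper , z-least = z , u<z , z<v , fz≈0
      where
      u≤z : u ≤ z
      u≤z = z-upper u (≤-refl , <⇒≤ u<v , pos-neg⇒≤0 fu<0)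
      z≤v : z ≤ v
      z≤v = z-least v λ x x∈S → proj₁ (proj₂ x∈S)
      fz≈0 : f z ≈ 0#
      fz≈0 with sign (f z)
      ... | is-zero e     = e
      ... | positive fz>0 = ⊥-elim (sup-nonpositive-≯0 p u v z z-upper z-least fz>0)
      ... | negative fz<0 = ⊥-elim (sup-nonpositive-≮0 p u v z z-upper u≤z z≤v fv>0 fz<0)
      z<v : z < v
      z<v = ≤∧≉⇒< z≤v λ z≈v → pos⇒≉0 fv>0 (≈-trans (poly-cong p (≈-sym z≈v)) fz≈0)
      u<z : u < z
      u<z = ≤∧≉⇒< u≤z λ u≈z → pos⇒≉0 fu<0
        (≈-trans (-‿cong (≈-trans (poly-cong p u≈z) fz≈0)) (solve 0 (:- :0 := :0) ≈-refl))

  abstract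
    -- The polynomial x² - w changes sign between 0 and w + 1, since (w + 1)² - w = w² + w + 1.
    square-root : Pos x → ∃[ s ] Pos s × s * s ≈ x
    square-root {w} w>0 =
      let (s , s>0 , _ , fs≈0) = intermediate-value p 0# (w + 1#)
            (pos-resp (solve 1 (λ w → w :+ :1 := w :+ :1 :- :0) ≈-refl w) (pos-+ w>0 1-pos))
            (pos-resp (solve 1 (λ w → w := :- (:0 :* :0 :- w)) ≈-refl w) w>0)
            (pos-resp (solve 1 (λ w → w :* w :+ w :+ :1 := (w :+ :1) :* (w :+ :1) :- w) ≈-refl w)
              (pos-+ (pos-+ (pos-* w>0 w>0) w>0) 1-pos))
      in s , pos-resp (solve 1 (λ s → s :- :0 := s) ≈-refl s) s>0 , x-y≈0⇒x≈y fs≈0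
      where
      p : Poly 2 (1# + 0#) (λ x → x * x - w)
      p = poly-resp (λ x → solve 2 (λ x w → (x :- :0) :* ((x :- :0) :* :1) :+ (:- w) := x :* x :- w)
        ≈-refl x w)
            (poly-+ (poly-shift 0# (poly-shift {f = λ _ → 1#} 0# (constant λ _ → ≈-refl)))
              (poly-const 1 (- w)))

  abstract
    -- Write f = x g + e with g ≥ m beyond M and |e| ≤ b. A uniform bound m, rather than mere
    -- positivity of g, is what absorbs e: from x ≥ M + 1 + b / m follows f ≥ m again.
    poly-eventually-positive : Pos c → Poly k c f →
      ∃[ m ] ∃[ M ] Pos m × 0# ≤ M × (∀ x → M ≤ x → m ≤ f x)
    poly-eventually-positive {c} c>0 (constant p) = c , 0# , c>0 , ≤-refl , λ x _ → ≤-reflexive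
      (≈-sym (p x))
    poly-eventually-positive {f = f} c>0 (divisible p) =
      let (g , e , pg , f≈)            = p 0#
          (m , M , m>0 , 0≤M , g≥m)   = poly-eventually-positive c>0 pg
          (b , w)                      = within-some e
          (i , mi≈1 , i>0)             = pos-inverse m>0
          0≤bi                         = *-nonneg (within-nonneg w) (pos⇒nonneg i>0)
          0≤1                          = pos⇒nonneg 1-pos
          N                            = M + (1# + b * i)
          0≤N-M                        = nonneg-+ 0≤1 0≤bi
      in m , N , m>0 , nonneg-+ 0≤M 0≤N-M , λ x N≤x →
        let 0≤x-N = ≤⇒nonneg N≤x
            M≤x   = nonneg⇒≤ (nonneg-resp
              (solve 3 (λ x M h → x :- (M :+ h) :+ h := x :- M) ≈-refl x M (1# + b * i))
              (nonneg-+ 0≤x-N 0≤N-M))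
            0≤x   = ≤-trans 0≤M M≤x
        in nonneg⇒≤ (nonneg-resp
          (begin
            x * (g x - m) + ((x - N + M) * m + (b + e))
              ≈⟨ solve 7 (λ x g m b e i M → x :* (g :- m) :+
                ((x :- (M :+ (:1 :+ b :* i)) :+ M) :* m :+ (b :+ e))
                    := x :* g :+ e :- m :+ b :* (:1 :- m :* i)) ≈-refl x (g x) m b e i M ⟩
            x * g x + e - m + b * (1# - m * i)
              ≈⟨ +-congˡ (*-congˡ (+-congˡ (-‿cong mi≈1))) ⟩
            x * g x + e - m + b * (1# - 1#)
              ≈⟨ solve 5 (λ x g e m b → x :* g :+ e :- m :+ b :* (:1 :- :1) :=
                (x :- :0) :* g :+ e :- m) ≈-refl x (g x) e m b ⟩
            (x - 0#) * g x + e - m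
              ≈⟨ +-congʳ (f≈ x) ⟨
            f x - m ∎)
          (nonneg-+ (*-nonneg 0≤x (≤⇒nonneg (g≥m x M≤x)))
            (nonneg-+ (*-nonneg (nonneg-+ 0≤x-N 0≤M) (pos⇒nonneg m>0)) (proj₂ w))))

-- Roots of polynomials from sign alternation, and interlacing.

module InterlacingRoots (ℝ : CompleteOrderedField) where

  open OrderedField ℝ
  open PolynomialFunctions ℝ
  open ≈-Reasoning

  private
    variable
      k m : ℕ
      c x y z s : Carrier
      f g h p q : Carrier → Carrier
      rs ss ys : Vec Carrier k

  <-trans : x < y → y < z → x < z
  <-trans {x} {y} {z} x<y y<z =
    pos-resp (solve 3 (λ x y z → y :- x :+ (z :- y) := z :- x) ≈-refl x y z) (pos-+ x<y y<z)

  pos-≤ : Pos x → x ≤ y → Pos y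
  pos-≤ x>0 x≤y y≤0 = x>0 (≤-trans x≤y y≤0)

  <-≤-trans : x < y → y ≤ z → x < z
  <-≤-trans {x} {y} {z} x<y y≤z =
    pos-resp (solve 3 (λ x y z → y :- x :+ (z :- y) := z :- x) ≈-refl x y z)
      (pos-+ˡ x<y (≤⇒nonneg y≤z))

  -x≈0⇒x≈0 : - x ≈ 0# → x ≈ 0#
  -x≈0⇒x≈0 {x} -x≈0 =
    ≈-trans (solve 1 (λ x → x := :- (:- x)) ≈-refl x)
      (≈-trans (-‿cong -x≈0) (solve 0 (:- :0 := :0) ≈-refl))

  x<x+1 : ∀ x → x < x + 1#
  x<x+1 x = pos-resp (solve 1 (λ x → :1 := x :+ :1 :- x) ≈-refl x) 1-pos

  Descending : Vec Carrier k → Set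
  Descending = AllPairs (λ a b → b < a)

  linears : Vec Carrier k → Carrier → Carrier
  linears []       x = 1#
  linears (r ∷ rs) x = (x - r) * linears rs x

  -- Each quotient keeps the leading coefficient and the remaining roots, because s - r is nonzero
  -- for distinct roots. After k divisions only the constant c is left.
  poly-factor : Poly k c f → (rs : Vec Carrier k) → Descending rs → All (λ r → f r ≈ 0#) rs →
                ∀ x → f x ≈ c * linears rs x
  poly-factor {c = c} (constant p) [] [] [] x = ≈-trans (p x) (≈-sym (*-identityʳ c))
  poly-factor {c = c} {f} p@(divisible _) (r ∷ rs) (rs<r ∷ desc) (fr≈0 ∷ roots) x
    with poly-divide p r
  ... | g , pg , f≈ = begin
    f x                          ≈⟨ f≈′ x ⟩
    (x - r) * g x
      ≈⟨ *-congˡ (poly-factor pg rs desc (All.map root (All.zip (rs<r , roots))) x) ⟩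
    (x - r) * (c * linears rs x)
      ≈⟨ solve 3 (λ y c l → y :* (c :* l) := c :* (y :* l)) ≈-refl (x - r) c (linears rs x) ⟩
    c * linears (r ∷ rs) x       ∎
    where
    f≈′ : ∀ x → f x ≈ (x - r) * g x
    f≈′ x = ≈-trans (f≈ x) (≈-trans (+-congˡ fr≈0) (+-identityʳ _))
    root : ∀ {s} → s < r × f s ≈ 0# → g s ≈ 0#
    root {s} (s<r , fs≈0) = x*y≈0⇒y≈0
      (λ s-r≈0 → pos⇒≉0 s<r (≈-trans (solve 2 (λ r s → r :- s := :- (s :- r)) ≈-refl r s)
                              (≈-trans (-‿cong s-r≈0) (solve 0 (:- :0 := :0) ≈-refl))))
      (≈-trans (≈-sym (f≈′ s)) fs≈0)

  infixr 5 _∷_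

  -- Negating the function at every entry encodes the signs +, -, +, ... without an index.
  data Alternating : (Carrier → Carrier) → Vec Carrier k → Set where
    []  : Alternating f []
    _∷_ : Pos (f y) → Alternating (λ x → - f x) ys → Alternating f (y ∷ ys)

  alternating-resp : All (λ y → f y ≈ g y) ys → Alternating f ys → Alternating g ys
  alternating-resp [] [] = []
  alternating-resp (e ∷ es) (p ∷ alt) = pos-resp e p ∷ alternating-resp (All.map -‿cong es) alt

  alternating-* : All (λ y → Pos (h y)) ys → Alternating f ys → Alternating (λ x → h x * f x) ys
  alternating-* [] [] = []
  alternating-* {h = h} {f = f} (hp ∷ hps) (p ∷ alt) = pos-* hp p ∷
    alternating-resp (All.universal
      (λ x → solve 2 (λ h f → h :* (:- f) := :- (h :* f)) ≈-refl (h x) (f x)) _)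
      (alternating-* hps alt)

  alternating-∷ʳ : {ys : Vec Carrier k} → Alternating f ys → Pos (sgn k * f y) → Alternating f
    (ys ∷ʳ y)
  alternating-∷ʳ [] fy>0 = pos-resp (*-identityˡ _) fy>0 ∷ []
  alternating-∷ʳ {suc k} {f} {y} (p ∷ alt) fy>0 = p ∷
    alternating-∷ʳ alt (pos-resp
      (solve 2 (λ s f → (:- s) :* f := s :* (:- f)) ≈-refl (sgn k) (f y)) fy>0)

  -- Strict interlacing y₀ > s₀ > y₁ > s₁ > ..., with one more outer point than inner points.
  data Between : Vec Carrier (suc k) → Vec Carrier k → Set where
    [_] : ∀ y → Between (y ∷ []) []
    _∷_ : y < s × s < x → Between (y ∷ ys) ss → Between (x ∷ y ∷ ys) (s ∷ ss)

  between⇒< : Between (y ∷ ys) ss → All (_< y) ss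
  between⇒< [ _ ] = []
  between⇒< ((y<s , s<x) ∷ btw) = s<x ∷ All.map (λ r<y → <-trans r<y (<-trans y<s s<x))
    (between⇒< btw)

  between⇒descending : Between ys ss → Descending ss
  between⇒descending [ _ ] = []
  between⇒descending ((y<s , _) ∷ btw) = All.map (λ r<y → <-trans r<y y<s)
    (between⇒< btw) ∷ between⇒descending btw

  between-roots : Poly k c f → {ys : Vec Carrier (suc m)} → Descending ys → Alternating f ys →
                  ∃[ ss ] Between ys ss × All (λ s → f s ≈ 0#) ss
  between-roots p {y ∷ []} desc alt = [] , [ y ] , []
  between-roots {f = f} p {x ∷ y ∷ ys} ((y<x ∷ _) ∷ desc) (fx>0 ∷ alt@(fy<0 ∷ _))
    = let (s , y<s , s<x , fs≈0) = intermediate-value p y x y<x fy<0 fx>0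
          (ss , btw , roots) = between-roots
            (poly-resp (λ x → solve 1 (λ f → :- :1 :* f := :- f) ≈-refl (f x))
              (poly-scale (- 1#) p)) desc alt
      in s ∷ ss , (y<s , s<x) ∷ btw , fs≈0 ∷ All.map -x≈0⇒x≈0 roots

  -- In x > s₀ > r₀ > s₁ > ... > y, forgetting the two extreme points exchanges the roles: now the s
  -- enclose the r.
  between-swap : {rs : Vec Carrier k} {ss : Vec Carrier (suc k)} → Between (x ∷ (rs ∷ʳ y)) ss →
    Between ss rs
  between-swap {rs = []} (_∷_ {s = s} _ [ _ ]) = [ s ]
  between-swap {rs = r ∷ rs} {s ∷ s′ ∷ ss} ((r<s , _) ∷ btw) =
    (All.head (between⇒< btw) , r<s) ∷ between-swap btw

  linears-pos : All (_< x) rs → Pos (linears rs x)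
  linears-pos [] = 1-pos
  linears-pos (r<x ∷ rs<x) = pos-* r<x (linears-pos rs<x)

  -- All factors are positive at the largest point, and each passage to the next point crosses
  -- exactly one root.
  linears-alternating : Between ss rs → Descending ss → Alternating (linears rs) ss
  linears-alternating [ _ ] _ = 1-pos ∷ []
  linears-alternating {rs = r ∷ rs} ((y<r , r<x) ∷ btw) (_ ∷ desc@(ys<y ∷ _)) =
    linears-pos (r<x ∷ All.map (λ s<y → <-trans s<y (<-trans y<r r<x)) (between⇒< btw)) ∷
    alternating-resp (All.universal
      (λ x → solve 3 (λ r x l → (r :- x) :* l := :- ((x :- r) :* l)) ≈-refl r x (linears rs x)) _)
      (alternating-* (y<r ∷ All.map (λ z<y → <-trans z<y y<r) ys<y) (linears-alternating btw desc))

  -- The map `h` allows the same search to bound the negated entries, which yields a point below the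
  -- list.
  bound-above : ∀ (h : Carrier → Carrier) (rs : Vec Carrier k) M → ∃[ y ] M ≤ y × All
    (λ r → h r < y) rs
  bound-above h [] M = M , ≤-refl , []
  bound-above h (r ∷ rs) M with bound-above h rs M
  ... | y , M≤y , rs<y with total (h r) y
  ... | inj₁ r≤y = y + 1# , ≤-trans M≤y (<⇒≤ (x<x+1 y)) ,
    pos-resp (solve 2 (λ r y → y :- r :+ :1 := y :+ :1 :- r) ≈-refl (h r) y)
      (pos-+ʳ (≤⇒nonneg r≤y) 1-pos) ∷
    All.map (λ s<y → <-trans s<y (x<x+1 y)) rs<y
  ... | inj₂ y≤r = h r + 1# , ≤-trans M≤y (≤-trans y≤r (<⇒≤ (x<x+1 (h r)))) ,
    x<x+1 (h r) ∷ All.map (λ s<y → <-trans (<-≤-trans s<y y≤r) (x<x+1 (h r))) rs<y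

  all-∷ʳ : ∀ {P : Carrier → Set} → All P rs → P y → All P (rs ∷ʳ y)
  all-∷ʳ [] Py = Py ∷ []
  all-∷ʳ (Pr ∷ Prs) Py = Pr ∷ all-∷ʳ Prs Py

  descending-∷ʳ : Descending rs → All (y <_) rs → Descending (rs ∷ʳ y)
  descending-∷ʳ [] [] = [] ∷ []
  descending-∷ʳ (rs<r ∷ desc) (y<r ∷ y<rs) = all-∷ʳ rs<r y<r ∷ descending-∷ʳ desc y<rs

  -- The signs of f at ±∞ extend the alternation by one point on each side.
  poly-roots : Pos c → Poly (suc k) c f → {rs : Vec Carrier k} → Descending rs → Alternating
    (λ x → - f x) rs →
               ∃[ ss ] Descending ss × Between ss rs × All (λ s → f s ≈ 0#) ss
  poly-roots {c} {k} {f} c>0 p {rs} desc alt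
    -- The reflected polynomial has leading coefficient (-1)^(k+1) c; the factor `sgn (suc k)` makes
    -- it positive, so that growth at plus infinity determines the sign of f at minus infinity.
    with poly-eventually-positive c>0 p
       | poly-eventually-positive
         (pos-resp (≈-trans (≈-sym (*-identityˡ c))
         (≈-trans (*-congʳ (≈-sym (sgn-square (suc k)))) (*-assoc _ _ _))) c>0)
           (poly-scale (sgn (suc k)) (poly-reflect p))
  ... | m , M , m>0 , _ , f≥m | n , N , n>0 , _ , f≥n
    with bound-above -_ rs N
  ... | y , N≤y , -rs<y
    -- Including `- y` orders the two outer points even when `rs` is empty.
    with bound-above id (- y ∷ rs) M
  ... | x , M≤x , -y<x ∷ rs<x
    with between-roots p
           (all-∷ʳ rs<x -y<x ∷ descending-∷ʳ desc
             (All.map (λ {r} → pos-resp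
             (solve 2 (λ r y → y :- (:- r) := r :- (:- y)) ≈-refl r y)) -rs<y))
           (pos-≤ m>0 (f≥m x M≤x) ∷ alternating-∷ʳ alt
             (pos-resp (solve 2 (λ s f → (:- s) :* f := s :* (:- f)) ≈-refl (sgn k) (f (- y)))
             (pos-≤ n>0 (f≥n y N≤y))))
  ... | ss , btw , roots = ss , between⇒descending btw , between-swap btw , roots

  -- The induction hypothesis for two consecutive members of the recurrence. Interlacing is recorded
  -- through the signs of `q` at the roots of `p`, which is the form that the recurrence consumes.
  record Interlacing (k : ℕ) (q p : Carrier → Carrier) : Set where
    field
      {leading lower} : Carrier
      leading>0   : Pos leading
      poly-p      : Poly k leading p
      poly-q      : Poly k lower q
      roots       : Vec Carrier k
      descending  : Descending roots
      is-root     : All (λ r → p r ≈ 0#) roots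
      alternating : Alternating q roots

  interlacing-linear : ∀ a → Interlacing 1 (λ _ → 1#) (λ x → x - a)
  interlacing-linear a = record
    { leading>0   = 1-pos
    ; poly-p      = poly-resp (λ x → *-identityʳ (x - a))
        (poly-shift {f = λ _ → 1#} a (constant λ _ → ≈-refl))
    ; poly-q      = poly-const 0 1#
    ; roots       = a ∷ []
    ; descending  = [] ∷ []
    ; is-root     = -‿inverseʳ a ∷ []
    ; alternating = 1-pos ∷ []
    }

  -- At the roots of p the new polynomial has the sign of - q, hence alternates there.
  interlacing-step : ∀ a {b γ} → Pos b → Pos γ → Interlacing k q p →
                     Interlacing (suc k) (λ x → γ * p x) (λ x → (x - a) * (γ * p x) - b * q x)
  interlacing-step {k} {q} {p} a {b} {γ} b>0 γ>0 I =
    with-roots (poly-roots leading′>0 poly-p′ descending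
           (alternating-resp (All.map neg-p′ is-root)
             (alternating-* (All.universal (λ _ → b>0) _) alternating)))
    where
    open Interlacing I
    poly-p′ : Poly (suc k) (γ * leading + 0#) (λ x → (x - a) * (γ * p x) - b * q x)
    poly-p′ = poly-resp (λ x → +-congˡ
      (solve 2 (λ b q → (:- b) :* q := :- (b :* q)) ≈-refl b (q x)))
      (poly-+ (poly-shift a (poly-scale γ poly-p)) (poly-lift (poly-scale (- b) poly-q)))
    leading′>0 : Pos (γ * leading + 0#)
    leading′>0 = pos-+ˡ (pos-* γ>0 leading>0) ≤-refl
    neg-p′ : ∀ {r} → p r ≈ 0# → b * q r ≈ - ((r - a) * (γ * p r) - b * q r)
    neg-p′ {r} pr≈0 = ≈-sym (≈-trans (-‿cong (+-congʳ (*-congˡ (*-congˡ pr≈0))))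
      (solve 5 (λ r a g b q → :- ((r :- a) :* (g :* :0) :- b :* q) := b :* q) ≈-refl r a γ b (q r)))
    with-roots : (∃[ ss ] Descending ss × Between ss roots × All
      (λ s → (s - a) * (γ * p s) - b * q s ≈ 0#) ss) →
                 Interlacing (suc k) (λ x → γ * p x) (λ x → (x - a) * (γ * p x) - b * q x)
    with-roots (ss , desc , btw , new-roots) = record
      { leading>0   = leading′>0
      ; poly-p      = poly-p′
      ; poly-q      = poly-lift (poly-scale γ poly-p)
      ; roots       = ss
      ; descending  = desc
      ; is-root     = new-roots
      -- By factorization γ p is a positive multiple of `linears roots`, which alternates at the new
      -- roots because they enclose the old ones.
      ; alternating = alternating-resp
          (All.universal (λ x → ≈-trans (*-assoc _ _ _)
            (*-congˡ (≈-sym (poly-factor poly-p roots descending is-root x)))) _)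
          (alternating-* (All.universal (λ _ → pos-* γ>0 leading>0) _)
            (linears-alternating btw desc))
      }

-- Tridiagonal matrices and their real eigenvalues.

module TridiagonalMatrices (ℝ : CompleteOrderedField) where

  open OrderedField ℝ
  open PolynomialFunctions ℝ
  open InterlacingRoots ℝ
  open ≈-Reasoning
  open LinearAlgebra ℝ public
  open Algebra.Properties.Semiring.Sum semiring public
    using (sum-cong-≋; *-distribˡ-sum; *-distribʳ-sum; ∑-comm; ∑-distrib-+;
      sum-remove; sum-permute; sum-replicate-zero)
    renaming (sum to ∑)

  private
    variable
      k n : ℕ
      f : Carrier → Carrier
      rs : Vec Carrier k

  sum-zero : {t : Vector Carrier n} → (∀ i → t i ≈ 0#) → ∑ t ≈ 0#
  sum-zero {n} t≈0 = ≈-trans (sum-cong-≋ t≈0) (sum-replicate-zero n)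

  -- Peeling off the first row and column makes the trailing blocks the objects of recursion. The
  -- entries next to the diagonal are positive on both sides, but not assumed symmetric.
  data Tridiagonal : ∀ n → Mat (suc n) → Set where
    single : ∀ B → Tridiagonal zero B
    block  : ∀ {n} B → Pos (B zero (suc zero)) → Pos (B (suc zero) zero) →
             (∀ j → B zero (suc (suc j)) ≈ 0#) → (∀ i → B (suc (suc i)) zero ≈ 0#) →
             Tridiagonal n (λ i j → B (suc i) (suc j)) → Tridiagonal (suc n) B

  path⇒tridiagonal : ∀ n (B : Mat (suc n)) → Nonnegative B →
                     (∀ i j → Γ B i j ⇔ (∣ toℕ i - toℕ j ∣ ≡ 1)) → Tridiagonal n B
  path⇒tridiagonal zero    B B≥0 path = single B
  path⇒tridiagonal (suc n) B B≥0 path = block B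
    (adjacent zero (suc zero) ≡.refl) (adjacent (suc zero) zero ≡.refl)
    (λ j → distant zero (suc (suc j)) (λ ()) λ ()) (λ i → distant (suc (suc i)) zero (λ ()) λ ())
    (path⇒tridiagonal n _ (λ i j → B≥0 (suc i) (suc j)) λ i j → record
      { to        = λ (i≢j , Bij≉0) → Equivalence.to (path (suc i) (suc j))
          ((λ { ≡.refl → i≢j ≡.refl }) , Bij≉0)
      ; from      = λ dist → let (i≢j , Bij≉0) = Equivalence.from (path (suc i) (suc j)) dist in
                                   (λ { ≡.refl → i≢j ≡.refl }) , Bij≉0
      ; to-cong   = λ { ≡.refl → ≡.refl }
      ; from-cong = λ { ≡.refl → ≡.refl }
      })
    where
    adjacent : ∀ i j → ∣ toℕ i - toℕ j ∣ ≡ 1 → Pos (B i j)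
    adjacent i j dist = nonneg∧≉0⇒pos (B≥0 i j) (proj₂ (Equivalence.from (path i j) dist))
    distant : ∀ i j → i ≢ j → ∣ toℕ i - toℕ j ∣ ≢ 1 → B i j ≈ 0#
    distant i j i≢j dist with B i j ≟ 0#
    ... | yes Bij≈0 = Bij≈0
    ... | no  Bij≉0 = ⊥-elim (dist (Equivalence.to (path i j) (i≢j , Bij≉0)))

  -- Detailed balance: A is self-adjoint for the inner product ∑ w i u i v i. The square roots of
  -- the weights will be the entries of Δ.
  Weights : Mat n → Vector Carrier n → Set
  Weights A w = (∀ i → Pos (w i)) × (∀ i j → w i * A i j ≈ w j * A j i)

  -- The first vertex meets only the second one, so its weight is subject to the single condition w₀
  -- B₀₁ = w₁ B₁₀.
  tridiagonal⇒weights : ∀ {B : Mat (suc n)} → Tridiagonal n B → ∃ (Weights B)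
  tridiagonal⇒weights (single B) = (λ _ → 1#) , (λ _ → 1-pos) , λ { zero zero → ≈-refl }
  tridiagonal⇒weights {suc n} (block B B₀₁>0 B₁₀>0 row≈0 col≈0 T)
    with tridiagonal⇒weights T | pos-inverse B₀₁>0
  ... | w′ , w′>0 , w′-sym | i , B₀₁i≈1 , i>0 = w , w>0 , w-sym
    where
    w : Vector Carrier (suc (suc n))
    w zero    = w′ zero * B (suc zero) zero * i
    w (suc k) = w′ k
    w>0 : ∀ k → Pos (w k)
    w>0 zero    = pos-* (pos-* (w′>0 zero) B₁₀>0) i>0
    w>0 (suc k) = w′>0 k
    corner : w zero * B zero (suc zero) ≈ w′ zero * B (suc zero) zero
    corner = ≈-trans
      (solve 4 (λ w b i c → w :* b :* i :* c := w :* b :* (c :* i)) ≈-refl (w′ zero)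
        (B (suc zero) zero) i (B zero (suc zero)))
      (≈-trans (*-congˡ B₀₁i≈1) (*-identityʳ _))
    both-zero : ∀ {a b x y} → x ≈ 0# → y ≈ 0# → a * x ≈ b * y
    both-zero x≈0 y≈0 = ≈-trans (≈-trans (*-congˡ x≈0) (zeroʳ _))
      (≈-sym (≈-trans (*-congˡ y≈0) (zeroʳ _)))
    w-sym : ∀ i j → w i * B i j ≈ w j * B j i
    w-sym zero          zero          = ≈-refl
    w-sym zero          (suc zero)    = corner
    w-sym zero          (suc (suc j)) = both-zero (row≈0 j) (col≈0 j)
    w-sym (suc zero)    zero          = ≈-sym corner
    w-sym (suc (suc i)) zero          = both-zero (col≈0 i) (row≈0 i)
    w-sym (suc i)       (suc j)       = w′-sym i j

  -- vector x solves all rows of (x - B) v = residual x · e₀, so that it is an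
  -- eigenvector of B exactly when the residual vanishes.
  record Resolvent {n} (B : Mat (suc n)) : Set where
    field
      vector      : Carrier → Vector Carrier (suc n)
      residual    : Carrier → Carrier
      row-zero    : ∀ x → (B ·ᵥ vector x) zero + residual x ≈ x * vector x zero
      row-suc     : ∀ x i → (B ·ᵥ vector x) (suc i) ≈ x * vector x (suc i)
      interlacing : Interlacing (suc n) (λ x → vector x zero) residual

  -- The old first row, now the second, forces the new entry v₀ = residual / B₁₀; the new first row
  -- then defines the new residual. This is the three-term recurrence of the characteristic
  -- polynomials of the trailing blocks, up to positive factors.
  tridiagonal⇒resolvent : ∀ {B : Mat (suc n)} → Tridiagonal n B → Resolvent B
  tridiagonal⇒resolvent (single B) = record
    { vector      = λ _ _ → 1#
    ; residual    = λ x → x - B zero zero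
    ; row-zero    = λ x → solve 2 (λ x b → b :* :1 :+ :0 :+ (x :- b) := x :* :1) ≈-refl x
        (B zero zero)
    ; row-suc     = λ _ ()
    ; interlacing = interlacing-linear (B zero zero)
    }
  tridiagonal⇒resolvent {suc n} (block B B₀₁>0 B₁₀>0 row≈0 col≈0 T)
    with tridiagonal⇒resolvent T | pos-inverse B₁₀>0
  ... | R | γ , B₁₀γ≈1 , γ>0 = record
    { vector      = v
    ; residual    = λ x → (x - B zero zero) * (γ * residual x) - B zero (suc zero) * vector x zero
    ; row-zero    = row₀
    ; row-suc     = row
    ; interlacing = interlacing-step (B zero zero) B₀₁>0 γ>0 interlacing
    }
    where
    open Resolvent R
    v : Carrier → Vector Carrier (suc (suc n))
    v x zero    = γ * residual x
    v x (suc i) = vector x i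
    row₀ : ∀ x → (B ·ᵥ v x) zero +
      ((x - B zero zero) * (γ * residual x) - B zero (suc zero) * vector x zero) ≈ x *
      (γ * residual x)
    row₀ x = ≈-trans
      (+-congʳ (+-congˡ (+-congˡ (sum-zero {n} λ j → ≈-trans (*-congʳ (row≈0 j)) (zeroˡ _)))))
      (solve 5 (λ x a g b u → a :* g :+ (b :* u :+ :0) :+ ((x :- a) :* g :- b :* u) := x :* g)
        ≈-refl
        x (B zero zero) (γ * residual x) (B zero (suc zero)) (vector x zero))
    row : ∀ x i → (B ·ᵥ v x) (suc i) ≈ x * vector x i
    row x zero = begin
      B (suc zero) zero * (γ * residual x) + _
        ≈⟨ +-congʳ (≈-trans (≈-sym (*-assoc _ _ _)) (≈-trans (*-congʳ B₁₀γ≈1) (*-identityˡ _))) ⟩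
      residual x + _                             ≈⟨ +-comm _ _ ⟩
      _ + residual x                             ≈⟨ row-zero x ⟩
      x * vector x zero                          ∎
    row x (suc i) = begin
      B (suc (suc i)) zero * (γ * residual x) + _
        ≈⟨ +-congʳ (≈-trans (*-congʳ (col≈0 i)) (zeroˡ _)) ⟩
      0# + _                                       ≈⟨ +-identityˡ _ ⟩
      _                                            ≈⟨ row-suc x i ⟩
      x * vector x (suc i)                         ∎

  record Eigensystem {n} (A : Mat n) : Set where
    field
      value    : Vector Carrier n
      vector   : Fin n → Vector Carrier n
      distinct : ∀ i j → value i ≈ value j → i ≡ j
      eigen    : ∀ i → Eigenspace A (value i) (vector i)
      nonzero  : ∀ i → ¬ (vector i ≈ᵥ 0ᵥ)

  descending-distinct : Descending rs → ∀ i j → Vec.lookup rs i ≈ Vec.lookup rs j → i ≡ j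
  descending-distinct (_ ∷ _) zero zero _ = ≡.refl
  descending-distinct (rs<r ∷ _) zero (suc j) e = ⊥-elim
    (pos⇒≉0 (Allₚ.lookup⁺ rs<r j) (x≈y⇒x-y≈0 e))
  descending-distinct (rs<r ∷ _) (suc i) zero e = ⊥-elim
    (pos⇒≉0 (Allₚ.lookup⁺ rs<r i) (x≈y⇒x-y≈0 (≈-sym e)))
  descending-distinct (_ ∷ desc) (suc i) (suc j) e = ≡.cong suc (descending-distinct desc i j e)

  alternating-≉0 : Alternating f rs → ∀ i → ¬ (f (Vec.lookup rs i) ≈ 0#)
  alternating-≉0 (p ∷ _)   zero    e = pos⇒≉0 p e
  alternating-≉0 (_ ∷ alt) (suc i) e = alternating-≉0 alt i
    (≈-trans (-‿cong e) (solve 0 (:- :0 := :0) ≈-refl))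

  -- At a root of the residual the first row also becomes an eigenvalue equation. The vector is
  -- nonzero because its first entry alternates in sign over the roots.
  resolvent⇒eigensystem : ∀ {B : Mat (suc n)} → Resolvent B → Eigensystem B
  resolvent⇒eigensystem {B = B} R = record
    { value    = Vec.lookup roots
    ; vector   = λ i → vector (Vec.lookup roots i)
    ; distinct = descending-distinct descending
    ; eigen    = λ { i zero    → ≈-trans (≈-sym (+-identityʳ _))
        (≈-trans (+-congˡ (≈-sym (Allₚ.lookup⁺ is-root i))) (row-zero _))
                   ; i (suc j) → row-suc _ j }
    ; nonzero  = λ i v≈0 → alternating-≉0 alternating i (v≈0 zero)
    }
    where
    open Resolvent R
    open Interlacing interlacing

-- Finite sums, matrix-vector algebra and one-sided inverses.

module MatrixAlgebra (ℝ : CompleteOrderedField) where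

  open OrderedField ℝ
  open TridiagonalMatrices ℝ
  open ≈-Reasoning

  private
    variable
      n : ℕ

  sum-single : (t : Vector Carrier n) (i : Fin n) → (∀ j → j ≢ i → t j ≈ 0#) → ∑ t ≈ t i
  sum-single {suc n} t i rest≈0 = ≈-trans (sum-remove {i = i} t)
    (≈-trans (+-congˡ (sum-zero λ j → rest≈0 (punchIn i j) (Finₚ.punchInᵢ≢i i j)))
      (+-identityʳ (t i)))

  sum-nonneg : (t : Vector Carrier n) → (∀ i → 0# ≤ t i) → 0# ≤ ∑ t
  sum-nonneg {zero}  t t≥0 = ≤-refl
  sum-nonneg {suc n} t t≥0 = nonneg-+ (t≥0 zero) (sum-nonneg (t ∘ suc) (t≥0 ∘ suc))

  sum-pos : (t : Vector Carrier n) → (∀ i → 0# ≤ t i) → ∀ i → Pos (t i) → Pos (∑ t)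
  sum-pos {suc n} t t≥0 i ti>0 =
    pos-resp (≈-sym (sum-remove {i = i} t)) (pos-+ˡ ti>0 (sum-nonneg _ λ j → t≥0 (punchIn i j)))

  vanishing? : (t : Vector Carrier n) → (∀ i → t i ≈ 0#) ⊎ (∃[ i ] ¬ (t i ≈ 0#))
  vanishing? t with Finₚ.any? (λ i → ¬? (t i ≟ 0#))
  ... | yes nonzero = inj₂ nonzero
  ... | no  none    = inj₁ λ i → decidable-stable (t i ≟ 0#) λ ti≉0 → none (i , ti≉0)

  sum-≉0 : (t : Vector Carrier n) → ¬ (∑ t ≈ 0#) → ∃[ i ] ¬ (t i ≈ 0#)
  sum-≉0 t ∑t≉0 with vanishing? t
  ... | inj₁ t≈0     = ⊥-elim (∑t≉0 (sum-zero t≈0))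
  ... | inj₂ nonzero = nonzero

  ∑-distrib-- : (f g : Vector Carrier n) → ∑ (λ i → f i - g i) ≈ ∑ f - ∑ g
  ∑-distrib-- f g = begin
    ∑ (λ i → f i - g i)
      ≈⟨ sum-cong-≋ (λ i → +-congˡ (solve 1 (λ x → :- x := :- :1 :* x) ≈-refl (g i))) ⟩
    ∑ (λ i → f i + - 1# * g i)       ≈⟨ ∑-distrib-+ f (λ i → - 1# * g i) ⟩
    ∑ f + ∑ (λ i → - 1# * g i)       ≈⟨ +-congˡ (*-distribˡ-sum (- 1#) g) ⟨
    ∑ f + - 1# * ∑ g                 ≈⟨ +-congˡ (solve 1 (λ x → :- :1 :* x := :- x) ≈-refl (∑ g)) ⟩
    ∑ f - ∑ g                        ∎

  I-diagonal : (i : Fin n) → I i i ≈ 1#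
  I-diagonal i with i Finₚ.≟ i
  ... | yes _   = ≈-refl
  ... | no  i≢i = ⊥-elim (i≢i ≡.refl)

  I-off : {i j : Fin n} → i ≢ j → I i j ≈ 0#
  I-off {i = i} {j} i≢j with i Finₚ.≟ j
  ... | yes i≡j = ⊥-elim (i≢j i≡j)
  ... | no  _   = ≈-refl

  I-·ᵥ : (v : Vector Carrier n) → I ·ᵥ v ≈ᵥ v
  I-·ᵥ v i = ≈-trans
    (sum-single _ i λ j j≢i → ≈-trans (*-congʳ (I-off (j≢i ∘ ≡.sym))) (zeroˡ _))
    (≈-trans (*-congʳ (I-diagonal i)) (*-identityˡ (v i)))

  ·ᵥ-I : (A : Mat n) (j : Fin n) → A ·ᵥ (λ k → I k j) ≈ᵥ λ i → A i j
  ·ᵥ-I A j i = ≈-trans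
    (sum-single _ j λ k k≢j → ≈-trans (*-congˡ (I-off k≢j)) (zeroʳ _))
    (≈-trans (*-congˡ (I-diagonal j)) (*-identityʳ (A i j)))

  ·ᵥ-cong : (A : Mat n) {v w : Vector Carrier n} → v ≈ᵥ w → A ·ᵥ v ≈ᵥ A ·ᵥ w
  ·ᵥ-cong A v≈w i = sum-cong-≋ λ k → *-congˡ (v≈w k)

  ·ᵥ-congʳ : {A B : Mat n} (v : Vector Carrier n) → A ≈ₘ B → A ·ᵥ v ≈ᵥ B ·ᵥ v
  ·ᵥ-congʳ v A≈B i = sum-cong-≋ λ k → *-congʳ (A≈B i k)

  ·ᵥ-0 : (A : Mat n) {v : Vector Carrier n} → v ≈ᵥ 0ᵥ → A ·ᵥ v ≈ᵥ 0ᵥ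
  ·ᵥ-0 A v≈0 i = sum-zero λ k → ≈-trans (*-congˡ (v≈0 k)) (zeroʳ _)

  ·ᵥ-∗ᵥ : (A : Mat n) (c : Carrier) (v : Vector Carrier n) → A ·ᵥ (c ∗ᵥ v) ≈ᵥ c ∗ᵥ (A ·ᵥ v)
  ·ᵥ-∗ᵥ A c v i = ≈-trans
    (sum-cong-≋ λ k → solve 3 (λ a c v → a :* (c :* v) := c :* (a :* v)) ≈-refl (A i k) c (v k))
    (≈-sym (*-distribˡ-sum c (λ k → A i k * v k)))

  ·ᵥ-assoc : (A B : Mat n) (v : Vector Carrier n) → (A · B) ·ᵥ v ≈ᵥ A ·ᵥ (B ·ᵥ v)
  ·ᵥ-assoc A B v i = begin
    ∑ (λ k → ∑ (λ l → A i l * B l k) * v k)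
      ≈⟨ sum-cong-≋ (λ k → *-distribʳ-sum (v k) (λ l → A i l * B l k)) ⟩
    ∑ (λ k → ∑ (λ l → A i l * B l k * v k))    ≈⟨ ∑-comm (λ k l → A i l * B l k * v k) ⟩
    ∑ (λ l → ∑ (λ k → A i l * B l k * v k))
      ≈⟨ sum-cong-≋ (λ l → sum-cong-≋ λ k → *-assoc (A i l) (B l k) (v k)) ⟩
    ∑ (λ l → ∑ (λ k → A i l * (B l k * v k)))
      ≈⟨ sum-cong-≋ (λ l → *-distribˡ-sum (A i l) (λ k → B l k * v k)) ⟨
    ∑ (λ l → A i l * ∑ (λ k → B l k * v k))    ∎

  -- A nonzero entry of the first row eliminates its row and column.
  kernel-vector : ∀ n (M : Fin n → Vector Carrier (suc n)) →
                  Σ[ c ∈ Vector Carrier (suc n) ] (∃[ j ] ¬ (c j ≈ 0#)) ×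
                    (∀ i → ∑ (λ j → M i j * c j) ≈ 0#)
  kernel-vector zero    M = (λ _ → 1#) , (zero , 1≉0) , λ ()
  kernel-vector (suc n) M with vanishing? (M zero)
  -- A zero row imposes no condition; a zero coefficient then discards the first column.
  ... | inj₁ M₀≈0 with kernel-vector n (λ i j → M (suc i) (suc j))
  ...   | c′ , (j , c′j≉0) , Mc′≈0 = c , (suc j , c′j≉0) , Mc≈0
    where
    c : Vector Carrier (suc (suc n))
    c zero    = 0#
    c (suc j) = c′ j
    Mc≈0 : ∀ i → ∑ (λ j → M i j * c j) ≈ 0#
    Mc≈0 zero    = sum-zero λ j → ≈-trans (*-congʳ (M₀≈0 j)) (zeroˡ (c j))
    Mc≈0 (suc i) = ≈-trans (+-cong (zeroʳ _) (Mc′≈0 i)) (+-identityˡ 0#)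
  kernel-vector (suc n) M | inj₂ (p , a≉0) with inverse (M zero p) a≉0
  -- The smaller system is the Schur complement of the pivot `M zero p`.
  ... | a⁻¹ , aa⁻¹≈1 with kernel-vector n
    (λ i j → M (suc i) (punchIn p j) - M (suc i) p * (a⁻¹ * M zero (punchIn p j)))
  ...   | c′ , (j , c′j≉0) , Mc′≈0 =
    c , (punchIn p j , λ cj≈0 → c′j≉0
      (≈-trans (≈-reflexive (≡.sym (Vecₚ.insertAt-punchIn c′ p e j))) cj≈0)) , Mc≈0
    where
    Σ′ : Fin (suc n) → Carrier
    Σ′ i = ∑ (λ j → M i (punchIn p j) * c′ j)
    -- The first row determines the coordinate at the pivot.
    e : Carrier
    e = - (a⁻¹ * Σ′ zero)
    c : Vector Carrier (suc (suc n))
    c = insertAt c′ p e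
    split : ∀ i → ∑ (λ j → M i j * c j) ≈ M i p * e + Σ′ i
    split i = ≈-trans (sum-remove {i = p} (λ j → M i j * c j))
      (+-cong (*-congˡ (≈-reflexive (Vecₚ.insertAt-lookup c′ p e)))
              (sum-cong-≋ λ j → *-congˡ {M i (punchIn p j)}
                (≈-reflexive (Vecₚ.insertAt-punchIn c′ p e j))))
    Mc≈0 : ∀ i → ∑ (λ j → M i j * c j) ≈ 0#
    Mc≈0 zero = begin
      ∑ (λ j → M zero j * c j)                    ≈⟨ split zero ⟩
      M zero p * e + Σ′ zero
        ≈⟨ solve 3 (λ a i s → a :* (:- (i :* s)) :+ s := s :- a :* i :* s) ≈-refl (M zero p) a⁻¹
        (Σ′ zero) ⟩
      Σ′ zero - M zero p * a⁻¹ * Σ′ zero          ≈⟨ +-congˡ (-‿cong (*-congʳ aa⁻¹≈1)) ⟩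
      Σ′ zero - 1# * Σ′ zero
        ≈⟨ solve 1 (λ s → s :- :1 :* s := :0) ≈-refl (Σ′ zero) ⟩
      0#                                          ∎
    Mc≈0 (suc i) = begin
      ∑ (λ j → M (suc i) j * c j)                 ≈⟨ split (suc i) ⟩
      m * e + Σ′ (suc i)
        ≈⟨ solve 4 (λ m i s t → m :* (:- (i :* s)) :+ t := t :- m :* i :* s) ≈-refl m a⁻¹ (Σ′ zero)
        (Σ′ (suc i)) ⟩
      Σ′ (suc i) - m * a⁻¹ * Σ′ zero
        ≈⟨ +-congˡ (-‿cong (*-distribˡ-sum (m * a⁻¹) (λ j → M zero (punchIn p j) * c′ j))) ⟩
      Σ′ (suc i) - ∑ (λ j → m * a⁻¹ * (M zero (punchIn p j) * c′ j))
                                                  ≈⟨ ∑-distrib-- (λ j → M (suc i)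
                                                    (punchIn p j) * c′ j) (λ j → m * a⁻¹ *
                                                    (M zero (punchIn p j) * c′ j)) ⟨
      ∑ (λ j → M (suc i) (punchIn p j) * c′ j - m * a⁻¹ * (M zero (punchIn p j) * c′ j))
                                                  ≈⟨ sum-cong-≋ (λ j → solve 5
                                                    (λ x m i y c → x :* c :- m :* i :* (y :* c) :=
                                                    (x :- m :* (i :* y)) :* c)
                                                       ≈-refl (M (suc i) (punchIn p j)) m a⁻¹
                                                         (M zero (punchIn p j)) (c′ j)) ⟩
      ∑ (λ j → (M (suc i) (punchIn p j) - m * (a⁻¹ * M zero (punchIn p j))) * c′ j)
                                                  ≈⟨ Mc′≈0 i ⟩
      0#                                          ∎
      where m = M (suc i) p

  -- Adjoin the unit vector e_k to the columns of P and take a linear relation. If e_k had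
  -- coefficient zero, P would kill a nonzero vector, against QP = I. Otherwise P b = e_k for some
  -- b; then b = QPb = Q e_k, so PQ fixes e_k.
  left-inverse⇒right-inverse : (P Q : Mat n) → Q · P ≈ₘ I → P · Q ≈ₘ I
  left-inverse⇒right-inverse {n} P Q QP≈I i k
    with kernel-vector n (λ { i zero → I i k ; i (suc m) → P i m })
  ... | c , (j , cj≉0) , c-kernel with c zero ≟ 0#
  ...   | yes c₀≈0 = ⊥-elim (cj≉0 (c≈0 j))
    where
    Pc≈0 : P ·ᵥ (c ∘ suc) ≈ᵥ 0ᵥ
    Pc≈0 i = ≈-trans (≈-sym (+-identityˡ _))
      (≈-trans (+-congʳ (≈-sym (≈-trans (*-congˡ c₀≈0) (zeroʳ _)))) (c-kernel i))
    c≈0 : ∀ j → c j ≈ 0#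
    c≈0 zero    = c₀≈0
    c≈0 (suc j) = begin
      c (suc j)                   ≈⟨ I-·ᵥ (c ∘ suc) j ⟨
      (I ·ᵥ (c ∘ suc)) j          ≈⟨ ·ᵥ-congʳ (c ∘ suc) QP≈I j ⟨
      (Q · P ·ᵥ (c ∘ suc)) j      ≈⟨ ·ᵥ-assoc Q P (c ∘ suc) j ⟩
      (Q ·ᵥ (P ·ᵥ (c ∘ suc))) j   ≈⟨ ·ᵥ-0 Q Pc≈0 j ⟩
      0#                          ∎
  ...   | no c₀≉0 with inverse (c zero) c₀≉0
  ...     | c₀⁻¹ , c₀c₀⁻¹≈1 = ≈-trans (·ᵥ-cong P Q≈b i) (Pb≈I i)
    where
    b : Vector Carrier n
    b = (- c₀⁻¹) ∗ᵥ (c ∘ suc)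
    Pb≈I : ∀ i → (P ·ᵥ b) i ≈ I i k
    Pb≈I i = begin
      (P ·ᵥ b) i                                   ≈⟨ ·ᵥ-∗ᵥ P (- c₀⁻¹) (c ∘ suc) i ⟩
      - c₀⁻¹ * Pc
        ≈⟨ solve 4 (λ c i x s → (:- i) :* s := x :* (c :* i) :- i :* (x :* c :+ s)) ≈-refl
        (c zero) c₀⁻¹ (I i k) Pc ⟩
      I i k * (c zero * c₀⁻¹) - c₀⁻¹ * (I i k * c zero + Pc)
        ≈⟨ +-cong (*-congˡ c₀c₀⁻¹≈1) (-‿cong (*-congˡ (c-kernel i))) ⟩
      I i k * 1# - c₀⁻¹ * 0#
        ≈⟨ solve 2 (λ x i → x :* :1 :- i :* :0 := x) ≈-refl (I i k) c₀⁻¹ ⟩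
      I i k                                        ∎
      where Pc = (P ·ᵥ (c ∘ suc)) i
    Q≈b : ∀ m → Q m k ≈ b m
    Q≈b m = begin
      Q m k                        ≈⟨ ·ᵥ-I Q k m ⟨
      (Q ·ᵥ (λ i → I i k)) m       ≈⟨ ·ᵥ-cong Q Pb≈I m ⟨
      (Q ·ᵥ (P ·ᵥ b)) m            ≈⟨ ·ᵥ-assoc Q P b m ⟨
      (Q · P ·ᵥ b) m               ≈⟨ ·ᵥ-congʳ b QP≈I m ⟩
      (I ·ᵥ b) m                   ≈⟨ I-·ᵥ b m ⟩
      b m                          ∎

-- Symmetrization, orthogonality and eigenbases.

module Diagonalizations (ℝ : CompleteOrderedField) where

  open OrderedField ℝ
  open PolynomialFunctions ℝ
  open TridiagonalMatrices ℝ
  open MatrixAlgebra ℝ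
  open ≈-Reasoning

  private
    variable
      n : ℕ

  weights-relabel : ∀ {A : Mat n} (π : Permutation′ n) →
                    ∃ (Weights (λ i j → A (π ⟨$⟩ʳ i) (π ⟨$⟩ʳ j))) → ∃ (Weights A)
  weights-relabel {A = A} π (w , w>0 , w-sym) = w ∘ (π ⟨$⟩ˡ_) , w>0 ∘ (π ⟨$⟩ˡ_) , λ i j →
    ≡.subst₂ (λ k l → w (π ⟨$⟩ˡ i) * A k l ≈ w (π ⟨$⟩ˡ j) * A l k) (inverseʳ π) (inverseʳ π)
      (w-sym (π ⟨$⟩ˡ i) (π ⟨$⟩ˡ j))

  eigensystem-relabel : ∀ {A : Mat n} (π : Permutation′ n) →
                        Eigensystem (λ i j → A (π ⟨$⟩ʳ i) (π ⟨$⟩ʳ j)) → Eigensystem A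
  eigensystem-relabel {A = A} π S = record
    { value    = value
    ; vector   = λ m → vector m ∘ (π ⟨$⟩ˡ_)
    ; distinct = distinct
    ; eigen    = λ m i → begin
        ∑ (λ k → A i k * vector m (π ⟨$⟩ˡ k))
          ≈⟨ sum-permute (λ k → A i k * vector m (π ⟨$⟩ˡ k)) π ⟩
        ∑ (λ k → A i (π ⟨$⟩ʳ k) * vector m (π ⟨$⟩ˡ (π ⟨$⟩ʳ k)))
          ≈⟨ sum-cong-≋ (λ k → *-cong
            (≈-reflexive (≡.cong (λ i → A i (π ⟨$⟩ʳ k)) (≡.sym (inverseʳ π))))
            (≈-reflexive (≡.cong (vector m) (inverseˡ π)))) ⟩
        ∑ (λ k → A (π ⟨$⟩ʳ (π ⟨$⟩ˡ i)) (π ⟨$⟩ʳ k) * vector m k)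
          ≈⟨ eigen m (π ⟨$⟩ˡ i) ⟩
        value m * vector m (π ⟨$⟩ˡ i) ∎
    ; nonzero  = λ m v≈0 → nonzero m λ i →
        ≈-trans (≈-reflexive (≡.cong (vector m) (≡.sym (inverseˡ π)))) (v≈0 (π ⟨$⟩ʳ i))
    }
    where open Eigensystem S

  diagonal : Vector Carrier n → Mat n
  diagonal f i j = f i * I i j

  diagonal-·ᵥ : (f v : Vector Carrier n) → diagonal f ·ᵥ v ≈ᵥ λ i → f i * v i
  diagonal-·ᵥ f v i = begin
    ∑ (λ k → f i * I i k * v k)    ≈⟨ sum-cong-≋ (λ k → *-assoc (f i) (I i k) (v k)) ⟩
    ∑ (λ k → f i * (I i k * v k))  ≈⟨ *-distribˡ-sum (f i) (λ k → I i k * v k) ⟨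
    f i * (I ·ᵥ v) i               ≈⟨ *-congˡ (I-·ᵥ v i) ⟩
    f i * v i                      ∎

  diagonal-inverse : (f g : Vector Carrier n) → (∀ i → f i * g i ≈ 1#) →
    diagonal f · diagonal g ≈ₘ I
  diagonal-inverse f g fg≈1 i j = ≈-trans (diagonal-·ᵥ f (λ k → diagonal g k j) i)
    (≈-trans (≈-sym (*-assoc _ _ _)) (≈-trans (*-congʳ (fg≈1 i)) (*-identityˡ _)))

  ·-diagonal : (A : Mat n) (g : Vector Carrier n) → ∀ i j → (A · diagonal g) i j ≈ A i j * g j
  ·-diagonal A g i j = ≈-trans
    (sum-single _ j λ k k≢j → ≈-trans (*-congˡ (≈-trans (*-congˡ (I-off k≢j)) (zeroʳ _))) (zeroʳ _))
    (*-congˡ (≈-trans (*-congˡ (I-diagonal j)) (*-identityʳ _)))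

  -- Take Δ with entries δ i = √(w i): symmetry of δ i A i j / δ j is the balance condition divided
  -- by δ i δ j.
  weights⇒symmetrizable : {A : Mat n} → ∃ (Weights A) → Symmetrizable A
  weights⇒symmetrizable {n} {A} (w , w>0 , w-sym) =
    diagonal δ , diagonal ε , (λ i j i≢j → ≈-trans (*-congˡ (I-off i≢j)) (zeroʳ _)) ,
    (diagonal-inverse δ ε δε≈1 , diagonal-inverse ε δ (λ i → ≈-trans (*-comm _ _) (δε≈1 i))) ,
    λ i j → begin
      (diagonal δ · A · diagonal ε) i j          ≈⟨ conjugate i j ⟩
      δ i * A i j * ε j                          ≈⟨ *-identityˡ _ ⟨
      1# * (δ i * A i j * ε j)                   ≈⟨ *-congʳ (δε≈1 i) ⟨
      δ i * ε i * (δ i * A i j * ε j)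
        ≈⟨ solve 4 (λ d e a f → d :* e :* (d :* a :* f) := d :* d :* a :* (e :* f)) ≈-refl (δ i)
        (ε i) (A i j) (ε j) ⟩
      δ i * δ i * A i j * (ε i * ε j)
        ≈⟨ *-congʳ (≈-trans (*-congʳ (δδ≈w i)) (≈-trans (w-sym i j) (*-congʳ (≈-sym (δδ≈w j))))) ⟩
      δ j * δ j * A j i * (ε i * ε j)
        ≈⟨ solve 4 (λ d e a f → d :* d :* a :* (e :* f) := d :* f :* (d :* a :* e)) ≈-refl (δ j)
        (ε i) (A j i) (ε j) ⟩
      δ j * ε j * (δ j * A j i * ε i)            ≈⟨ *-congʳ (δε≈1 j) ⟩
      1# * (δ j * A j i * ε i)                   ≈⟨ *-identityˡ _ ⟩
      δ j * A j i * ε i                          ≈⟨ conjugate j i ⟨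
      (diagonal δ · A · diagonal ε) j i          ∎
    where
    δ ε : Vector Carrier n
    δ i = proj₁ (square-root (w>0 i))
    ε i = proj₁ (pos-inverse (proj₁ (proj₂ (square-root (w>0 i)))))
    δδ≈w : ∀ i → δ i * δ i ≈ w i
    δδ≈w i = proj₂ (proj₂ (square-root (w>0 i)))
    δε≈1 : ∀ i → δ i * ε i ≈ 1#
    δε≈1 i = proj₁ (proj₂ (pos-inverse (proj₁ (proj₂ (square-root (w>0 i))))))
    conjugate : ∀ i j → (diagonal δ · A · diagonal ε) i j ≈ δ i * A i j * ε j
    conjugate i j = ≈-trans (·-diagonal (diagonal δ · A) ε i j)
      (*-congʳ (diagonal-·ᵥ δ (λ k → A k j) i))

  -- The columns of `P` form an eigenbasis and `Q ·ᵥ v` lists the coordinates of v in it. Repeated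
  -- eigenvalues are allowed, so that their distinctness can be derived afterwards.
  record Diagonalization {n} (A : Mat n) : Set where
    field
      P Q   : Mat n
      PQ≈I  : P · Q ≈ₘ I
      QP≈I  : Q · P ≈ₘ I
      value : Vector Carrier n
      eigen : ∀ m → Eigenspace A (value m) (λ i → P i m)

    expand : ∀ v → P ·ᵥ (Q ·ᵥ v) ≈ᵥ v
    expand v i = ≈-trans (≈-sym (·ᵥ-assoc P Q v i)) (≈-trans (·ᵥ-congʳ v PQ≈I i) (I-·ᵥ v i))

    A·P : ∀ v → A ·ᵥ (P ·ᵥ v) ≈ᵥ P ·ᵥ (λ m → value m * v m)
    A·P v i = begin
      (A ·ᵥ (P ·ᵥ v)) i                ≈⟨ ·ᵥ-assoc A P v i ⟨
      ∑ (λ m → (A · P) i m * v m)      ≈⟨ sum-cong-≋ (λ m → *-congʳ (eigen m i)) ⟩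
      ∑ (λ m → value m * P i m * v m)
        ≈⟨ sum-cong-≋ (λ m → solve 3 (λ a p v → a :* p :* v := p :* (a :* v)) ≈-refl (value m)
        (P i m) (v m)) ⟩
      ∑ (λ m → P i m * (value m * v m)) ∎

    -- In eigencoordinates A acts diagonally: apply Q to A v = A P (Q v).
    coordinates : ∀ {μ v} → Eigenspace A μ v → ∀ m → value m * (Q ·ᵥ v) m ≈ μ * (Q ·ᵥ v) m
    coordinates {μ} {v} Av≈μv m = begin
      value m * (Q ·ᵥ v) m                          ≈⟨ I-·ᵥ (λ m → value m * (Q ·ᵥ v) m) m ⟨
      (I ·ᵥ (λ m → value m * (Q ·ᵥ v) m)) m
        ≈⟨ ·ᵥ-congʳ (λ m → value m * (Q ·ᵥ v) m) QP≈I m ⟨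
      (Q · P ·ᵥ (λ m → value m * (Q ·ᵥ v) m)) m     ≈⟨ ·ᵥ-assoc Q P _ m ⟩
      (Q ·ᵥ (P ·ᵥ (λ m → value m * (Q ·ᵥ v) m))) m  ≈⟨ ·ᵥ-cong Q (A·P (Q ·ᵥ v)) m ⟨
      (Q ·ᵥ (A ·ᵥ (P ·ᵥ (Q ·ᵥ v)))) m               ≈⟨ ·ᵥ-cong Q (·ᵥ-cong A (expand v)) m ⟩
      (Q ·ᵥ (A ·ᵥ v)) m                             ≈⟨ ·ᵥ-cong Q Av≈μv m ⟩
      (Q ·ᵥ (μ ∗ᵥ v)) m                             ≈⟨ ·ᵥ-∗ᵥ Q μ v m ⟩
      μ * (Q ·ᵥ v) m                                ∎

    coordinate-≉0⇒≈ : ∀ {μ v} → Eigenspace A μ v → ∀ {m} → ¬ ((Q ·ᵥ v) m ≈ 0#) → μ ≈ value m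
    coordinate-≉0⇒≈ {μ} {v} Av≈μv {m} qv≉0 = x-y≈0⇒x≈y (x*y≈0⇒y≈0 qv≉0
      (≈-trans (solve 3 (λ q a b → q :* (a :- b) := a :* q :- b :* q) ≈-refl ((Q ·ᵥ v) m) μ
        (value m))
               (x≈y⇒x-y≈0 (≈-sym (coordinates Av≈μv m)))))

    coordinate-≈0 : ∀ {μ v} → Eigenspace A μ v → ∀ {m} → ¬ (μ ≈ value m) → (Q ·ᵥ v) m ≈ 0#
    coordinate-≈0 {μ} {v} Av≈μv {m} μ≉ = decidable-stable ((Q ·ᵥ v) m ≟ 0#) λ qv≉0 → μ≉
      (coordinate-≉0⇒≈ Av≈μv qv≉0)

    exhaustive : ∀ μ → Eigenvalue A μ → ∃[ m ] μ ≈ value m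
    exhaustive μ (v , Av≈μv , v≉0) with vanishing? (Q ·ᵥ v)
    ... | inj₁ Qv≈0        = ⊥-elim (v≉0 λ i → ≈-trans (≈-sym (expand v i)) (·ᵥ-0 P Qv≈0 i))
    ... | inj₂ (m , qvm≉0) = m , coordinate-≉0⇒≈ Av≈μv qvm≉0

    column-≉0 : ∀ m → ¬ ((λ i → P i m) ≈ᵥ 0ᵥ)
    column-≉0 m Pm≈0 = 1≉0 (≈-trans (≈-sym (I-diagonal m))
      (≈-trans (≈-sym (QP≈I m m)) (·ᵥ-0 Q Pm≈0 m)))

    eigenvalue : ∀ m → Eigenvalue A (value m)
    eigenvalue m = (λ i → P i m) , eigen m , column-≉0 m

    Distinct : Set
    Distinct = ∀ l m → value l ≈ value m → l ≡ m

    -- When the eigenvalues differ, every coordinate of an eigenvector vanishes except the one for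
    -- its own eigenvalue.
    eigenspace-multiple : Distinct → ∀ {m μ} → μ ≈ value m → ∀ {v} → Eigenspace A μ v → ∀ i → v i
      ≈ P i m * (Q ·ᵥ v) m
    eigenspace-multiple distinct {m} μ≈ {v} Av≈μv i = ≈-trans (≈-sym (expand v i))
      (sum-single _ m λ l l≢m → ≈-trans
        (*-congˡ (coordinate-≈0 Av≈μv λ μ≈l → l≢m (distinct l m (≈-trans (≈-sym μ≈l) μ≈))))
        (zeroʳ _))

    diagonalizable : Diagonalizable A
    diagonalizable = P , Q , (PQ≈I , QP≈I) , λ l m l≢m → begin
      (Q · A · P) l m                     ≈⟨ ·ᵥ-assoc Q A (λ i → P i m) l ⟩
      (Q ·ᵥ (A ·ᵥ (λ i → P i m))) l       ≈⟨ ·ᵥ-cong Q (eigen m) l ⟩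
      (Q ·ᵥ (value m ∗ᵥ (λ i → P i m))) l ≈⟨ ·ᵥ-∗ᵥ Q (value m) (λ i → P i m) l ⟩
      value m * (Q · P) l m               ≈⟨ *-congˡ (≈-trans (QP≈I l m) (I-off l≢m)) ⟩
      value m * 0#                        ≈⟨ zeroʳ _ ⟩
      0#                                  ∎

    multiplicityFree : Distinct → MultiplicityFree A
    multiplicityFree distinct = diagonalizable , λ μ μ-eigenvalue →
      let (m , μ≈) = exhaustive μ μ-eigenvalue in
      (λ _ i → P i m) , record
        { members     = λ _ i → ≈-trans (eigen m i) (*-congʳ (≈-sym μ≈))
        ; independent = λ { c c≈0 zero → begin
            c zero                                  ≈⟨ *-identityʳ _ ⟨
            c zero * 1#                             ≈⟨ *-congˡ (≈-trans (QP≈I m m) (I-diagonal m)) ⟨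
            c zero * (Q ·ᵥ (λ i → P i m)) m         ≈⟨ ·ᵥ-∗ᵥ Q (c zero) (λ i → P i m) m ⟨
            (Q ·ᵥ (c zero ∗ᵥ (λ i → P i m))) m
              ≈⟨ ·ᵥ-0 Q (λ i → ≈-trans (≈-sym (+-identityʳ _)) (c≈0 i)) m ⟩
            0#                                      ∎ }
        ; spanning    = λ w w∈ → (λ _ → (Q ·ᵥ w) m) , λ i →
            ≈-trans (eigenspace-multiple distinct μ≈ w∈ i)
              (≈-trans (*-comm _ _) (≈-sym (+-identityʳ _)))
        }

  -- Eigenvectors for distinct eigenvalues are orthogonal with respect to the weights.
  eigensystem⇒diagonalization : {A : Mat n} → ∃ (Weights A) → Eigensystem A →
    Σ[ D ∈ Diagonalization A ] Diagonalization.Distinct D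
  eigensystem⇒diagonalization {n} {A} (w , w>0 , w-sym) S = record
    { P = P ; Q = Q ; PQ≈I = left-inverse⇒right-inverse P Q QP≈I ; QP≈I = QP≈I ; value =
        value ; eigen = eigen } , distinct
    where
    open Eigensystem S
    ⟨_,_⟩ : Vector Carrier n → Vector Carrier n → Carrier
    ⟨ u , v ⟩ = ∑ (λ i → w i * u i * v i)
    scaleˡ : ∀ a u v → ⟨ a ∗ᵥ u , v ⟩ ≈ a * ⟨ u , v ⟩
    scaleˡ a u v = ≈-trans
      (sum-cong-≋ λ i → solve 4 (λ w a u v → w :* (a :* u) :* v := a :* (w :* u :* v)) ≈-refl
        (w i) a (u i) (v i))
      (≈-sym (*-distribˡ-sum a (λ i → w i * u i * v i)))
    symmetric : ∀ u v → ⟨ u , v ⟩ ≈ ⟨ v , u ⟩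
    symmetric u v = sum-cong-≋ λ i → solve 3 (λ w u v → w :* u :* v := w :* v :* u) ≈-refl (w i)
      (u i) (v i)
    respˡ : ∀ {u u′} v → u ≈ᵥ u′ → ⟨ u , v ⟩ ≈ ⟨ u′ , v ⟩
    respˡ v u≈u′ = sum-cong-≋ λ i → *-congʳ (*-congˡ (u≈u′ i))
    form : ∀ u v → ⟨ A ·ᵥ u , v ⟩ ≈ ∑ (λ i → ∑ (λ k → w i * A i k * (u k * v i)))
    form u v = sum-cong-≋ λ i → begin
      w i * (A ·ᵥ u) i * v i
        ≈⟨ solve 3 (λ w s v → w :* s :* v := w :* v :* s) ≈-refl (w i) ((A ·ᵥ u) i) (v i) ⟩
      w i * v i * (A ·ᵥ u) i
        ≈⟨ *-distribˡ-sum (w i * v i) (λ k → A i k * u k) ⟩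
      ∑ (λ k → w i * v i * (A i k * u k))
        ≈⟨ sum-cong-≋ (λ k → solve 4 (λ w v a u → w :* v :* (a :* u) := w :* a :* (u :* v)) ≈-refl
        (w i) (v i) (A i k) (u k)) ⟩
      ∑ (λ k → w i * A i k * (u k * v i))          ∎
    self-adjoint : ∀ u v → ⟨ A ·ᵥ u , v ⟩ ≈ ⟨ A ·ᵥ v , u ⟩
    self-adjoint u v = begin
      ⟨ A ·ᵥ u , v ⟩                                 ≈⟨ form u v ⟩
      ∑ (λ i → ∑ (λ k → w i * A i k * (u k * v i)))  ≈⟨ ∑-comm (λ i k → w i * A i k * (u k * v i)) ⟩
      ∑ (λ k → ∑ (λ i → w i * A i k * (u k * v i)))
        ≈⟨ sum-cong-≋ (λ k → sum-cong-≋ λ i → *-cong (w-sym i k) (*-comm (u k) (v i))) ⟩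
      ∑ (λ k → ∑ (λ i → w k * A k i * (v i * u k)))  ≈⟨ form v u ⟨
      ⟨ A ·ᵥ v , u ⟩                                 ∎
    -- By self-adjointness, multiplying the product of the two eigenvectors by either eigenvalue
    -- gives the same result.
    orthogonal : ∀ l m → l ≢ m → ⟨ vector l , vector m ⟩ ≈ 0#
    orthogonal l m l≢m = x*y≈0⇒y≈0 {value l - value m} (λ θ≈ → l≢m (distinct l m (x-y≈0⇒x≈y θ≈)))
      (begin
      (value l - value m) * ⟨ vl , vm ⟩
        ≈⟨ solve 3 (λ a b s → (a :- b) :* s := a :* s :- b :* s) ≈-refl
             (value l) (value m) ⟨ vl , vm ⟩ ⟩
      value l * ⟨ vl , vm ⟩ - value m * ⟨ vl , vm ⟩
        ≈⟨ +-cong (≈-trans (≈-sym (scaleˡ (value l) vl vm)) (respˡ vm (λ i → ≈-sym (eigen l i))))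
                  (-‿cong (≈-trans (*-congˡ (symmetric vl vm))
                    (≈-trans (≈-sym (scaleˡ (value m) vm vl)) (respˡ vl (λ i → ≈-sym (eigen m i)))))) ⟩
      ⟨ A ·ᵥ vl , vm ⟩ - ⟨ A ·ᵥ vm , vl ⟩            ≈⟨ x≈y⇒x-y≈0 (self-adjoint vl vm) ⟩
      0#                                             ∎)
      where
      vl = vector l
      vm = vector m
    norm>0 : ∀ m → Pos ⟨ vector m , vector m ⟩
    norm>0 m with vanishing? (vector m)
    ... | inj₁ vm≈0        = ⊥-elim (nonzero m vm≈0)
    ... | inj₂ (i , vmi≉0) = sum-pos _
      (λ j → nonneg-resp (≈-sym (*-assoc _ _ _))
        (*-nonneg (pos⇒nonneg (w>0 j)) (square-nonneg (vector m j)))) i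
      (pos-resp (≈-sym (*-assoc _ _ _)) (pos-* (w>0 i) (≉0⇒pos-square vmi≉0)))
    norm⁻¹ : Fin n → Carrier
    norm⁻¹ m = proj₁ (pos-inverse (norm>0 m))
    -- Orthogonality makes the dual basis explicit: its rows are the eigenvectors, weighted by w and
    -- divided by their norms.
    P Q : Mat n
    P i m = vector m i
    Q m i = norm⁻¹ m * (w i * vector m i)
    QP≈norm : ∀ m l → (Q · P) m l ≈ norm⁻¹ m * ⟨ vector m , vector l ⟩
    QP≈norm m l = ≈-trans (sum-cong-≋ λ i → *-assoc (norm⁻¹ m) (w i * vector m i) (vector l i))
                          (≈-sym (*-distribˡ-sum (norm⁻¹ m) (λ i → w i * vector m i * vector l i)))
    QP≈I : Q · P ≈ₘ I
    QP≈I m l with m Finₚ.≟ l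
    ... | yes ≡.refl = ≈-trans (QP≈norm m m)
      (≈-trans (*-comm _ _) (proj₁ (proj₂ (pos-inverse (norm>0 m)))))
    ... | no  m≢l    = ≈-trans (QP≈norm m l) (≈-trans (*-congˡ (orthogonal m l m≢l)) (zeroʳ _))

-- Primitive idempotents and the spectral expansion of powers.

module PrimitiveIdempotents (ℝ : CompleteOrderedField) where

  open OrderedField ℝ
  open TridiagonalMatrices ℝ
  open MatrixAlgebra ℝ
  open Diagonalizations ℝ

  open Algebra.Properties.Semiring.Exp semiring public using (_^_)
  open ≈-Reasoning

  private
    variable
      n : ℕ

  -- Since A p = P (Q A p) for a column p of P, and column m of the diagonal matrix QAP has a single
  -- entry, that entry is the eigenvalue.
  diagonalizable⇒diagonalization : {A : Mat n} → Diagonalizable A → Diagonalization A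
  diagonalizable⇒diagonalization {A = A} (P , Q , (PQ≈I , QP≈I) , diag) = record
    { P = P ; Q = Q ; PQ≈I = PQ≈I ; QP≈I = QP≈I ; value = λ m → (Q · A · P) m m ; eigen = λ m i →
        begin
        (A ·ᵥ (λ i → P i m)) i                  ≈⟨ I-·ᵥ (A ·ᵥ (λ i → P i m)) i ⟨
        (I ·ᵥ (A ·ᵥ (λ i → P i m))) i           ≈⟨ ·ᵥ-congʳ (A ·ᵥ (λ i → P i m)) PQ≈I i ⟨
        (P · Q ·ᵥ (A ·ᵥ (λ i → P i m))) i       ≈⟨ ·ᵥ-assoc P Q (A ·ᵥ (λ i → P i m)) i ⟩
        (P ·ᵥ (Q ·ᵥ (A ·ᵥ (λ i → P i m)))) i    ≈⟨ ·ᵥ-cong P (·ᵥ-assoc Q A (λ i → P i m)) i ⟨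
        (P ·ᵥ (λ l → (Q · A · P) l m)) i
          ≈⟨ sum-single _ m (λ l l≢m → ≈-trans (*-congˡ (diag l m l≢m)) (zeroʳ _)) ⟩
        P i m * (Q · A · P) m m                 ≈⟨ *-comm _ _ ⟩
        (Q · A · P) m m * P i m                 ∎ }

  -- Two columns with one eigenvalue would be multiples α b and β b of a single vector, so β P_l = α
  -- P_m. Row l of Q turns this into β = 0, which makes a column of P vanish.
  multiplicityFree⇒distinct : {A : Mat n} (D : Diagonalization A) →
    (∀ θ → Eigenvalue A θ → HasDimension (Eigenspace A θ) 1) → Diagonalization.Distinct D
  multiplicityFree⇒distinct {n} {A} D one-dim l m θl≈θm with l Finₚ.≟ m
  ... | yes l≡m = l≡m
  ... | no  l≢m = ⊥-elim (column-≉0 m λ i → ≈-trans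
    (proj₂ (multiple m (λ i → ≈-trans (eigen m i) (*-congʳ (≈-sym θl≈θm)))) i)
                                                    (≈-trans (*-congʳ β≈0) (zeroˡ _)))
    where
    open Diagonalization D
    basis = one-dim (value l) (eigenvalue l)
    b : Vector Carrier n
    b = proj₁ basis zero
    multiple : ∀ k → Eigenspace A (value l) (λ i → P i k) → ∃[ α ] ∀ i → P i k ≈ α * b i
    multiple k Pk∈ = let (c , Pk≈) = IsBasis.spanning (proj₂ basis) _ Pk∈ in c zero , λ i → ≈-trans
                           (Pk≈ i) (+-identityʳ _)
    α = proj₁ (multiple l (eigen l))
    Pl≈ = proj₂ (multiple l (eigen l))
    β = proj₁ (multiple m (λ i → ≈-trans (eigen m i) (*-congʳ (≈-sym θl≈θm))))
    Pm≈ = proj₂ (multiple m (λ i → ≈-trans (eigen m i) (*-congʳ (≈-sym θl≈θm))))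
    dependent : ∀ i → β * P i l ≈ α * P i m
    dependent i = ≈-trans (*-congˡ (Pl≈ i))
      (≈-trans (solve 3 (λ b a x → b :* (a :* x) := a :* (b :* x)) ≈-refl β α (b i))
        (*-congˡ (≈-sym (Pm≈ i))))
    β≈0 : β ≈ 0#
    β≈0 = begin
      β                                  ≈⟨ *-identityʳ β ⟨
      β * 1#                             ≈⟨ *-congˡ (≈-trans (QP≈I l l) (I-diagonal l)) ⟨
      β * (Q · P) l l                    ≈⟨ ·ᵥ-∗ᵥ Q β (λ i → P i l) l ⟨
      (Q ·ᵥ (β ∗ᵥ λ i → P i l)) l        ≈⟨ ·ᵥ-cong Q dependent l ⟩
      (Q ·ᵥ (α ∗ᵥ λ i → P i m)) l        ≈⟨ ·ᵥ-∗ᵥ Q α (λ i → P i m) l ⟩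
      α * (Q · P) l m                    ≈⟨ *-congˡ (≈-trans (QP≈I l m) (I-off l≢m)) ⟩
      α * 0#                             ≈⟨ zeroʳ α ⟩
      0#                                 ∎

  distinct⇒ordering : {A : Mat n} (D : Diagonalization A) → Diagonalization.Distinct D →
                      IsEigenvalueOrdering A (Diagonalization.value D)
  distinct⇒ordering D distinct =
    record { distinct = distinct ; eigenvalue = eigenvalue ; exhaustive = exhaustive }
    where open Diagonalization D

  idempotent : {A : Mat n} → Diagonalization A → Fin n → Mat n
  idempotent D m i j = P i m * Q m j
    where open Diagonalization D

  idempotent-·ᵥ : {A : Mat n} (D : Diagonalization A) → let open Diagonalization D in ∀ m v i →
                  (idempotent D m ·ᵥ v) i ≈ P i m * (Q ·ᵥ v) m
  idempotent-·ᵥ D m v i = ≈-trans (sum-cong-≋ λ j → *-assoc (P i m) (Q m j) (v j))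
    (≈-sym (*-distribˡ-sum (P i m) (λ j → Q m j * v j)))
    where open Diagonalization D

  -ₘ-·ᵥ : (A B : Mat n) (v : Vector Carrier n) → ∀ i → ((A -ₘ B) ·ᵥ v) i ≈ (A ·ᵥ v) i - (B ·ᵥ v) i
  -ₘ-·ᵥ A B v i = ≈-trans
    (sum-cong-≋ λ k → solve 3 (λ a b v → (a :- b) :* v := a :* v :- b :* v) ≈-refl (A i k) (B i k)
      (v k))
    (∑-distrib-- (λ k → A i k * v k) (λ k → B i k * v k))

  idempotent-isPrimitive : {A : Mat n} (D : Diagonalization A) → Diagonalization.Distinct D → ∀ m →
                           IsPrimitiveIdempotent A (Diagonalization.value D) m (idempotent D m)
  idempotent-isPrimitive D distinct m =
    (λ v v∈ i → ≈-trans (-ₘ-·ᵥ (idempotent D m) I v i) (x≈y⇒x-y≈0 (≈-trans (idempotent-·ᵥ D m v i)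
      (≈-trans (≈-sym (eigenspace-multiple distinct ≈-refl v∈ i)) (≈-sym (I-·ᵥ v i)))))) ,
    (λ j j≢m v v∈ i → ≈-trans (idempotent-·ᵥ D m v i)
      (≈-trans (*-congˡ (coordinate-≈0 v∈ λ θ≈ → j≢m (distinct j m θ≈))) (zeroʳ _)))
    where open Diagonalization D

  power : Mat n → ℕ → Mat n
  power A zero    = I
  power A (suc k) = A · power A k

  power-·ᵥ : (A : Mat n) → ∀ {θ v} → Eigenspace A θ v → ∀ k → power A k ·ᵥ v ≈ᵥ (θ ^ k) ∗ᵥ v
  power-·ᵥ A {θ} {v} Av≈θv zero    i = ≈-trans (I-·ᵥ v i) (≈-sym (*-identityˡ (v i)))
  power-·ᵥ A {θ} {v} Av≈θv (suc k) i = begin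
    (A · power A k ·ᵥ v) i      ≈⟨ ·ᵥ-assoc A (power A k) v i ⟩
    (A ·ᵥ (power A k ·ᵥ v)) i   ≈⟨ ·ᵥ-cong A (power-·ᵥ A Av≈θv k) i ⟩
    (A ·ᵥ ((θ ^ k) ∗ᵥ v)) i     ≈⟨ ·ᵥ-∗ᵥ A (θ ^ k) v i ⟩
    θ ^ k * (A ·ᵥ v) i          ≈⟨ *-congˡ (Av≈θv i) ⟩
    θ ^ k * (θ * v i)
      ≈⟨ solve 3 (λ p t v → p :* (t :* v) := t :* p :* v) ≈-refl (θ ^ k) θ (v i) ⟩
    θ * θ ^ k * v i             ∎

  -- As M = (M P) Q, a matrix is determined by its action on the columns of P.
  eigenbasis-ext : {A : Mat n} (D : Diagonalization A) →
    let open Diagonalization D in {M N : Mat n} →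
                   (∀ m → M ·ᵥ (λ i → P i m) ≈ᵥ N ·ᵥ (λ i → P i m)) → M ≈ₘ N
  eigenbasis-ext D {M} {N} M≈N i j = ≈-trans (≈-sym (via M))
    (≈-trans (sum-cong-≋ λ m → *-congʳ (M≈N m i)) (via N))
    where
    open Diagonalization D
    via : ∀ M → ((M · P) ·ᵥ (λ k → Q k j)) i ≈ M i j
    via M = ≈-trans (·ᵥ-assoc M P (λ k → Q k j) i)
      (≈-trans (·ᵥ-cong M (λ k → PQ≈I k j) i) (·ᵥ-I M j i))

  -- Each column of P lies in the eigenspace of some θ i, where E i acts as the identity and the
  -- other idempotents vanish; both sides multiply it by θ i ^ k.
  power-expansion : {A : Mat n} → Diagonalization A → {θ : Vector Carrier n} →
    IsEigenvalueOrdering A θ →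
                    (E : Fin n → Mat n) → (∀ i → IsPrimitiveIdempotent A θ i (E i)) →
                    ∀ k → power A k ≈ₘ λ a b → ∑ (λ i → θ i ^ k * E i a b)
  power-expansion {n} {A} D {θ} ordering E prim k = eigenbasis-ext D λ m a →
    let (i , φ≈θ) = exhaustive′ (value m) (eigenvalue m)
        u         = λ b → P b m
        u∈        = λ b → ≈-trans (eigen m b) (*-congʳ φ≈θ)
    in begin
      (power A k ·ᵥ u) a                          ≈⟨ power-·ᵥ A u∈ k a ⟩
      θ i ^ k * u a                               ≈⟨ *-congˡ (fixed i u u∈ a) ⟨
      θ i ^ k * (E i ·ᵥ u) a                      ≈⟨ sum-single (λ j → θ j ^ k * (E j ·ᵥ u) a) i
             (λ j j≢i → ≈-trans (*-congˡ (proj₂ (prim j) i (j≢i ∘ ≡.sym) u u∈ a)) (zeroʳ _)) ⟨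
      ∑ (λ j → θ j ^ k * (E j ·ᵥ u) a)
        ≈⟨ sum-cong-≋ (λ j → *-distribˡ-sum (θ j ^ k) (λ b → E j a b * u b)) ⟩
      ∑ (λ j → ∑ (λ b → θ j ^ k * (E j a b * u b)))  ≈⟨ ∑-comm (λ j b → θ j ^ k * (E j a b * u b)) ⟩
      ∑ (λ b → ∑ (λ j → θ j ^ k * (E j a b * u b)))
        ≈⟨ sum-cong-≋ (λ b → ≈-trans (*-distribʳ-sum (u b) (λ j → θ j ^ k * E j a b))
                               (sum-cong-≋ λ j → *-assoc (θ j ^ k) (E j a b) (u b))) ⟨
      ∑ (λ b → ∑ (λ j → θ j ^ k * E j a b) * u b) ∎
    where
    open Diagonalization D hiding (exhaustive)
    open IsEigenvalueOrdering ordering using () renaming (exhaustive to exhaustive′)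
    fixed : ∀ i u → Eigenspace A (θ i) u → ∀ a → (E i ·ᵥ u) a ≈ u a
    fixed i u u∈ a = ≈-trans
      (x-y≈0⇒x≈y (≈-trans (≈-sym (-ₘ-·ᵥ (E i) I u a)) (proj₁ (prim i) u u∈ a))) (I-·ᵥ u a)

-- Moments of weighted nodes and difference products.

module Moments (ℝ : CompleteOrderedField) where

  open OrderedField ℝ
  open TridiagonalMatrices ℝ
  open MatrixAlgebra ℝ
  open PrimitiveIdempotents ℝ
  open ≈-Reasoning

  private
    variable
      n : ℕ

  moment : Vector Carrier n → Vector Carrier n → ℕ → Carrier
  moment θ w k = ∑ (λ i → θ i ^ k * w i)

  -- The factor that a difference product loses with the node p moves into the weight.
  reducedWeight : Vector Carrier (suc n) → Vector Carrier (suc n) → Fin (suc n) → Vector Carrier n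
  reducedWeight θ w p j = (θ (punchIn p j) - θ p) * w (punchIn p j)

  -- Removing the node θ p replaces the moments μ k by μ (k + 1) - θ p μ k without changing
  -- the weighted difference products; the induction below compares two removed nodes.
  moment-reduce : (θ w : Vector Carrier (suc n)) → ∀ p k →
    moment (removeAt θ p) (reducedWeight θ w p) k ≈ moment θ w (suc k) - θ p * moment θ w k
  moment-reduce θ w p k = ≈-sym (begin
    moment θ w (suc k) - θ p * moment θ w k
      ≈⟨ +-congˡ (-‿cong (*-distribˡ-sum (θ p) (λ i → θ i ^ k * w i))) ⟩
    moment θ w (suc k) - ∑ (λ i → θ p * (θ i ^ k * w i))
      ≈⟨ ∑-distrib-- (λ i → θ i ^ suc k * w i) (λ i → θ p * (θ i ^ k * w i)) ⟨
    ∑ (λ i → θ i * θ i ^ k * w i - θ p * (θ i ^ k * w i))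
      ≈⟨ sum-cong-≋ (λ i → solve 4
        (λ t u p w → t :* p :* w :- u :* (p :* w) := p :* ((t :- u) :* w)) ≈-refl (θ i) (θ p)
        (θ i ^ k) (w i)) ⟩
    ∑ (λ i → θ i ^ k * ((θ i - θ p) * w i))
      ≈⟨ sum-remove {i = p} (λ i → θ i ^ k * ((θ i - θ p) * w i)) ⟩
    θ p ^ k * ((θ p - θ p) * w p) + moment (removeAt θ p) (reducedWeight θ w p) k
      ≈⟨ solve 4 (λ q t w s → q :* ((t :- t) :* w) :+ s := s) ≈-refl (θ p ^ k) (θ p) (w p) _ ⟩
    moment (removeAt θ p) (reducedWeight θ w p) k ∎)

  differenceProduct-reduce₀ : (θ w : Vector Carrier (suc (suc n))) → ∀ j →
    reducedWeight θ w zero j * differenceProduct (removeAt θ zero) j ≈ w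
      (suc j) * differenceProduct θ (suc j)
  differenceProduct-reduce₀ θ w j =
    solve 3 (λ d w p → d :* w :* p := w :* (d :* p)) ≈-refl (θ (suc j) - θ zero) (w (suc j)) _

  -- Only the nodes 0 and 1 are ever removed. Behind both of them, the two cases differ in the order
  -- of the first two factors.
  differenceProduct-reduce₁ : (θ w : Vector Carrier (suc (suc n))) → ∀ j →
    reducedWeight θ w (suc zero) j * differenceProduct (removeAt θ (suc zero)) j
      ≈ w (punchIn (suc zero) j) * differenceProduct θ (punchIn (suc zero) j)
  differenceProduct-reduce₁ θ w zero =
    solve 3 (λ d w p → d :* w :* p := w :* (d :* p)) ≈-refl (θ zero - θ (suc zero)) (w zero) _
  differenceProduct-reduce₁ {suc n} θ w (suc j) =
    solve 4 (λ d e w p → d :* w :* (e :* p) := w :* (e :* (d :* p))) ≈-refl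
      (θ (suc (suc j)) - θ (suc zero)) (θ (suc (suc j)) - θ zero) (w (suc (suc j))) _

  -- Write μ k for the moments. Removing node 0 and removing node 1 give the same value for μ (k +
  -- 1) - θ p μ k, namely 0 below n and c at n. The difference is (θ 1 - θ 0) μ k, so μ k vanishes
  -- up to k = n, and then μ (n + 1) = c.
  moments-vanish : ∀ n (θ w : Vector Carrier (suc n)) → (∀ i j → θ i ≈ θ j → i ≡ j) → ∀ {c} →
    (∀ i → w i * differenceProduct θ i ≈ c) → (∀ k → k ℕ.< n → moment θ w k ≈ 0#) × moment θ w n ≈ c
  moments-vanish zero θ w distinct {c} w∏≈c = (λ _ ()) ,
    ≈-trans (solve 1 (λ w → :1 :* w :+ :0 := w :* :1) ≈-refl (w zero)) (w∏≈c zero)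
  moments-vanish (suc n) θ w distinct {c} w∏≈c = vanish , top
    where
    reduced : ∀ p → (∀ j → reducedWeight θ w p j * differenceProduct (removeAt θ p) j ≈ c) →
      (∀ k → k ℕ.< n → moment θ w (suc k) - θ p * moment θ w k ≈ 0#) × moment θ w
        (suc n) - θ p * moment θ w n ≈ c
    reduced p w∏≈c =
      let (lower , leading) = moments-vanish n (removeAt θ p) (reducedWeight θ w p)
            (λ i j e → Finₚ.punchIn-injective p i j (distinct _ _ e)) w∏≈c
      in (λ k k<n → ≈-trans (≈-sym (moment-reduce θ w p k)) (lower k k<n)) ,
         ≈-trans (≈-sym (moment-reduce θ w p n)) leading
    r₀ = reduced zero λ j → ≈-trans (differenceProduct-reduce₀ θ w j) (w∏≈c (suc j))
    r₁ = reduced (suc zero) λ j → ≈-trans (differenceProduct-reduce₁ θ w j)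
      (w∏≈c (punchIn (suc zero) j))
    compare : ∀ k → moment θ w (suc k) - θ zero * moment θ w k ≈ moment θ w (suc k) - θ
      (suc zero) * moment θ w k →
              moment θ w k ≈ 0#
    compare k e = x*y≈0⇒y≈0 {θ (suc zero) - θ zero} (λ θ≈ → 1≢0 (distinct _ _ (x-y≈0⇒x≈y θ≈)))
      (≈-trans (solve 4 (λ a b s t → (b :- a) :* s := (t :- a :* s) :- (t :- b :* s)) ≈-refl
        (θ zero) (θ (suc zero)) (moment θ w k) (moment θ w (suc k)))
               (x≈y⇒x-y≈0 e))
      where
      1≢0 : Fin.suc zero ≢ zero
      1≢0 ()
    moment-n≈0 : moment θ w n ≈ 0#
    moment-n≈0 = compare n (≈-trans (proj₂ r₀) (≈-sym (proj₂ r₁)))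
    vanish : ∀ k → k ℕ.< suc n → moment θ w k ≈ 0#
    vanish k k<1+n with ℕₚ.m≤n⇒m<n∨m≡n k<1+n
    ... | inj₁ (s≤s k<n) = compare k (≈-trans (proj₁ r₀ k k<n) (≈-sym (proj₁ r₁ k k<n)))
    ... | inj₂ ≡.refl = moment-n≈0
    top : moment θ w (suc n) ≈ c
    top = ≈-trans (solve 2 (λ s a → s := s :- a :* :0) ≈-refl (moment θ w (suc n)) (θ zero))
      (≈-trans (+-congˡ (-‿cong (*-congˡ (≈-sym moment-n≈0)))) (proj₂ r₀))

  -- With the lower moments zero, the reduced moments are the old ones shifted by one. Every index
  -- survives the removal of some other node: index 0 that of node 1, the rest that of node 0.
  moments-determine : ∀ n (θ w : Vector Carrier (suc n)) → ∀ {c} →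
    (∀ k → k ℕ.< n → moment θ w k ≈ 0#) → moment θ w n ≈ c → ∀ i → w i * differenceProduct θ i ≈ c
  moments-determine zero θ w lower leading zero =
    ≈-trans (solve 1 (λ w → w :* :1 := :1 :* w :+ :0) ≈-refl (w zero)) leading
  moments-determine (suc n) θ w {c} lower leading = λ where
      zero    → ≈-trans (≈-sym (differenceProduct-reduce₁ θ w zero)) (reduced (suc zero) zero)
      (suc j) → ≈-trans (≈-sym (differenceProduct-reduce₀ θ w j)) (reduced zero j)
    where
    step : ∀ p k → k ℕ.< suc n → ∀ {a} → moment θ w (suc k) ≈ a → moment (removeAt θ p)
      (reducedWeight θ w p) k ≈ a
    step p k k<1+n {a} e = ≈-trans (moment-reduce θ w p k)
      (≈-trans (+-cong e (-‿cong (*-congˡ (lower k k<1+n))))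
        (solve 2 (λ a t → a :- t :* :0 := a) ≈-refl a (θ p)))
    reduced : ∀ p j → reducedWeight θ w p j * differenceProduct (removeAt θ p) j ≈ c
    reduced p = moments-determine n (removeAt θ p) (reducedWeight θ w p)
      (λ k k<n → step p k (ℕₚ.m<n⇒m<1+n k<n) (lower (suc k) (s≤s k<n)))
        (step p n (ℕₚ.n<1+n n) leading)

-- Walks, shortest walks and bidirected paths.

module Paths (ℝ : CompleteOrderedField) where

  open OrderedField ℝ
  open TridiagonalMatrices ℝ
  open MatrixAlgebra ℝ
  open Diagonalizations ℝ
  open PrimitiveIdempotents ℝ
  open ≈-Reasoning

  private
    variable
      n : ℕ

  ∣-∣≡1-intro : ∀ {m n} → m ≢ n → m ℕ.≤ suc n → n ℕ.≤ suc m → ∣ m - n ∣ ≡ 1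
  ∣-∣≡1-intro {zero}        {zero}        m≢n _ _ = ⊥-elim (m≢n ≡.refl)
  ∣-∣≡1-intro {zero}        {suc zero}    _ _ _ = ≡.refl
  ∣-∣≡1-intro {zero}        {suc (suc n)} _ _ (s≤s ())
  ∣-∣≡1-intro {suc zero}    {zero}        _ _ _ = ≡.refl
  ∣-∣≡1-intro {suc (suc m)} {zero}        _ (s≤s ()) _
  ∣-∣≡1-intro {suc m}       {suc n}       m≢n (s≤s m≤) (s≤s n≤) = ∣-∣≡1-intro
    (m≢n ∘ ≡.cong suc) m≤ n≤

  ∣-∣≡1-elim : ∀ {m n} → ∣ m - n ∣ ≡ 1 → n ≡ suc m ⊎ m ≡ suc n
  ∣-∣≡1-elim {zero}  {suc n} e = inj₁ e
  ∣-∣≡1-elim {suc m} {zero}  e = inj₂ e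
  ∣-∣≡1-elim {suc m} {suc n} e with ∣-∣≡1-elim {m} {n} e
  ... | inj₁ n≡1+m = inj₁ (≡.cong suc n≡1+m)
  ... | inj₂ m≡1+n = inj₂ (≡.cong suc m≡1+n)

  -- A missed value could be punched out, giving an injection into a smaller set.
  injective⇒permutation : (f : Fin n → Fin n) → (∀ {i j} → f i ≡ f j → i ≡ j) →
                          Σ[ π ∈ Permutation′ n ] (∀ i → π ⟨$⟩ʳ i ≡ f i)
  injective⇒permutation {n} f f-injective =
    permutation f (proj₁ ∘ preimage) (proj₂ ∘ preimage)
      (λ i → f-injective (proj₂ (preimage (f i)))) , λ _ → ≡.refl
    where
    avoids⇒⊥ : ∀ {n} (f : Fin n → Fin n) → (∀ {i j} → f i ≡ f j → i ≡ j) → ∀ y → ¬ (∀ i → y ≢ f i)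
    avoids⇒⊥ {suc n} f f-injective y y≢f =
      ℕₚ.1+n≰n (Finₚ.injective⇒≤ {f = λ i → punchOut (y≢f i)} λ e → f-injective
        (Finₚ.punchOut-injective (y≢f _) (y≢f _) e))
    preimage : ∀ y → ∃[ i ] f i ≡ y
    preimage y with Finₚ.any? (λ i → f i Finₚ.≟ y)
    ... | yes found = found
    ... | no  none  = ⊥-elim (avoids⇒⊥ f f-injective y λ i y≡fi → none (i , ≡.sym y≡fi))

  I-pos⇒≡ : {i j : Fin n} → Pos (I i j) → i ≡ j
  I-pos⇒≡ {i = i} {j} I>0 with i Finₚ.≟ j
  ... | yes i≡j = i≡j
  ... | no  _   = ⊥-elim (I>0 ≤-refl)

  -- Positive entries of powers as walks.

  module _ {A : Mat n} (A≥0 : Nonnegative A) where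

    power-nonneg : ∀ k → Nonnegative (power A k)
    power-nonneg zero u v with u Finₚ.≟ v
    ... | yes _ = pos⇒nonneg 1-pos
    ... | no  _ = ≤-refl
    power-nonneg (suc k) u v = sum-nonneg _ λ l → *-nonneg (A≥0 u l) (power-nonneg k l v)

    power-cons : ∀ k {u v w} → Pos (A u v) → Pos (power A k v w) → Pos (power A (suc k) u w)
    power-cons k {u} {v} {w} a>0 p>0 = sum-pos _ (λ l → *-nonneg (A≥0 u l) (power-nonneg k l w)) v
      (pos-* a>0 p>0)

    power-uncons : ∀ k {u w} → Pos (power A (suc k) u w) → ∃[ v ] Pos (A u v) × Pos (power A k v w)
    power-uncons k {u} {w} p>0 =
      let (v , ap≉0) = sum-≉0 (λ l → A u l * power A k l w) (pos⇒≉0 p>0) in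
      v , nonneg∧≉0⇒pos (A≥0 u v) (λ a≈0 → ap≉0 (≈-trans (*-congʳ a≈0) (zeroˡ _))) ,
          nonneg∧≉0⇒pos (power-nonneg k v w) (λ p≈0 → ap≉0 (≈-trans (*-congˡ p≈0) (zeroʳ _)))

    power-1 : ∀ {u v} → Pos (A u v) → Pos (power A 1 u v)
    power-1 {u} {v} a>0 = power-cons 0 {w = v} a>0 (pos-resp (≈-sym (I-diagonal v)) 1-pos)

    power-++ : ∀ j k {u v w} → Pos (power A j u v) → Pos (power A k v w) → Pos
      (power A (j ℕ.+ k) u w)
    power-++ zero k {w = w} p>0 q>0 = ≡.subst (λ u → Pos (power A k u w)) (≡.sym (I-pos⇒≡ p>0)) q>0
    power-++ (suc j) k p>0 q>0 = let (v , a>0 , p′>0) = power-uncons j p>0 in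
      power-cons (j ℕ.+ k) a>0 (power-++ j k p′>0 q>0)

    -- Indexing by all of ℕ, constant past the end, avoids bounds in later index arithmetic.
    power⇒walk : ∀ k {u t} → Pos (power A k u t) →
      Σ[ x ∈ (ℕ → Fin n) ] x 0 ≡ u × x k ≡ t × (∀ i → i ℕ.< k → Pos (A (x i) (x (suc i))))
    power⇒walk zero {u} p>0 = (λ _ → u) , ≡.refl , I-pos⇒≡ p>0 , λ _ ()
    power⇒walk (suc k) {u} p>0 =
      let (v , a>0 , p′>0)          = power-uncons k p>0
          (x , x₀≡v , xₖ≡t , edges) = power⇒walk k p′>0
      in (λ { zero → u ; (suc i) → x i }) , ≡.refl , xₖ≡t ,
         λ { zero _ → ≡.subst (λ v → Pos (A u v)) (≡.sym x₀≡v) a>0 ; (suc i) (s≤s i<k) →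
           edges i i<k }

  -- Conjugation by a diagonal matrix multiplies each entry by nonzero factors, so A inherits the
  -- symmetric zero pattern of its conjugate.
  symmetrizable-≉0 : (A : Mat n) → Symmetrizable A → ∀ i j → ¬ (A i j ≈ 0#) → ¬ (A j i ≈ 0#)
  symmetrizable-≉0 A (Δ , Δ⁻¹ , diag , (ΔΔ⁻¹≈I , _) , symm) i j Aij≉0 Aji≈0 =
    *-≉0 (*-≉0 (Δ≉0 i) Aij≉0) (Δ⁻¹≉0 j) (begin
      Δ i i * A i j * Δ⁻¹ j j    ≈⟨ conjugate i j ⟨
      (Δ · A · Δ⁻¹) i j          ≈⟨ symm i j ⟩
      (Δ · A · Δ⁻¹) j i          ≈⟨ conjugate j i ⟩
      Δ j j * A j i * Δ⁻¹ i i    ≈⟨ *-congʳ (≈-trans (*-congˡ Aji≈0) (zeroʳ _)) ⟩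
      0# * Δ⁻¹ i i               ≈⟨ zeroˡ _ ⟩
      0#                         ∎)
    where
    Δ-row : ∀ v i → (Δ ·ᵥ v) i ≈ Δ i i * v i
    Δ-row v i = sum-single _ i λ k k≢i → ≈-trans (*-congʳ (diag i k (k≢i ∘ ≡.sym))) (zeroˡ _)
    unit : ∀ i → Δ i i * Δ⁻¹ i i ≈ 1#
    unit i = ≈-trans (≈-sym (Δ-row (λ k → Δ⁻¹ k i) i)) (≈-trans (ΔΔ⁻¹≈I i i) (I-diagonal i))
    Δ≉0 : ∀ i → ¬ (Δ i i ≈ 0#)
    Δ≉0 i e = 1≉0 (≈-trans (≈-sym (unit i)) (≈-trans (*-congʳ e) (zeroˡ _)))
    Δ⁻¹≉0 : ∀ i → ¬ (Δ⁻¹ i i ≈ 0#)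
    Δ⁻¹≉0 i e = 1≉0 (≈-trans (≈-sym (unit i)) (≈-trans (*-congˡ e) (zeroʳ _)))
    -- Diagonality is given for Δ alone; the rows of ΔΔ⁻¹ = I carry it over.
    Δ⁻¹-diagonal : Diagonal Δ⁻¹
    Δ⁻¹-diagonal k j k≢j = x*y≈0⇒y≈0 (Δ≉0 k)
      (≈-trans (≈-sym (Δ-row (λ l → Δ⁻¹ l j) k)) (≈-trans (ΔΔ⁻¹≈I k j) (I-off k≢j)))
    conjugate : ∀ i j → (Δ · A · Δ⁻¹) i j ≈ Δ i i * A i j * Δ⁻¹ j j
    conjugate i j = ≈-trans
      (sum-single _ j λ k k≢j → ≈-trans (*-congˡ (Δ⁻¹-diagonal k j k≢j)) (zeroʳ _))
      (*-congʳ (Δ-row (λ k → A k j) i))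

  -- A walk of length d from s to t is shortest, so it cannot repeat vertices or skip
  -- forward; having d + 1 vertices, it visits all of them.
  powers⇒path : ∀ {d} {A : Mat (suc d)} → Nonnegative A → Symmetrizable A → ∀ {s t} →
    (∀ k → k ℕ.< d → power A k s t ≈ 0#) → ¬ (power A d s t ≈ 0#) → IsBidirectedPath (Γ A) s t
  powers⇒path {d} {A} A≥0 symmetrizable {s} {t} short≈0 d≉0 =
    from-walk (power⇒walk A≥0 d (nonneg∧≉0⇒pos (power-nonneg A≥0 d s t) d≉0))
    where
    from-walk : Σ[ x ∈ (ℕ → Fin (suc d)) ] x 0 ≡ s × x d ≡ t ×
      (∀ i → i ℕ.< d → Pos (A (x i) (x (suc i)))) →
                IsBidirectedPath (Γ A) s t
    from-walk (x , x₀≡s , xd≡t , edges) =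
      let (π , π≡x) = injective⇒permutation (x ∘ toℕ) (λ {i} {j} → x-injective i j) in
      π , ≡.trans (π≡x zero) x₀≡s , ≡.trans (π≡x (fromℕ d))
        (≡.trans (≡.cong x (Finₚ.toℕ-fromℕ d)) xd≡t) ,
      λ i j → ≡.subst₂ (λ u v → Γ A u v ⇔ (∣ toℕ i - toℕ j ∣ ≡ 1)) (≡.sym (π≡x i)) (≡.sym (π≡x j))
        (mk⇔ (adjacent i j) (edge i j))
      where
      segment : ∀ i k → i ℕ.+ k ℕ.≤ d → Pos (power A k (x i) (x (i ℕ.+ k)))
      segment i zero    _ = ≡.subst (λ j → Pos (I (x i) (x j))) (≡.sym (ℕₚ.+-identityʳ i))
        (pos-resp (≈-sym (I-diagonal (x i))) 1-pos)
      segment i (suc k) i+k≤d = power-cons A≥0 k (edges i (ℕₚ.≤-trans (s≤s (ℕₚ.m≤m+n i k)) 1+i+k≤d))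
        (≡.subst (λ j → Pos (power A k (x (suc i)) (x j))) (≡.sym (ℕₚ.+-suc i k))
          (segment (suc i) k 1+i+k≤d))
        where
        1+i+k≤d : suc i ℕ.+ k ℕ.≤ d
        1+i+k≤d = ≡.subst (ℕ._≤ d) (ℕₚ.+-suc i k) i+k≤d
      -- Inserting the k steps into the walk would lead from s to t in i + k + (d - j) steps, fewer
      -- than d if i + k < j.
      no-shortcut : ∀ {i j k} → i ℕ.≤ d → j ℕ.≤ d → Pos (power A k (x i) (x j)) → j ℕ.≤ i ℕ.+ k
      no-shortcut {i} {j} {k} i≤d j≤d p>0 = ℕₚ.≮⇒≥ λ i+k<j →
        pos⇒≉0
          (power-++ A≥0 i (k ℕ.+ (d ℕ.∸ j))
            (≡.subst (λ u → Pos (power A i u (x i))) x₀≡s (segment 0 i i≤d))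
            (power-++ A≥0 k (d ℕ.∸ j) p>0
              (≡.subst (λ v → Pos (power A (d ℕ.∸ j) (x j) v))
              (≡.trans (≡.cong x (ℕₚ.m+[n∸m]≡n j≤d)) xd≡t)
              (segment j (d ℕ.∸ j) (ℕₚ.≤-reflexive (ℕₚ.m+[n∸m]≡n j≤d))))))
          (short≈0 _ (≡.subst₂ ℕ._<_ (ℕₚ.+-assoc i k (d ℕ.∸ j)) (ℕₚ.m+[n∸m]≡n j≤d)
            (ℕₚ.+-monoˡ-< (d ℕ.∸ j) i+k<j)))
      -- Equal vertices are joined by a walk of length 0, an edge is one of length 1; these two
      -- cases exclude repetitions and forward jumps.
      x-≤ : ∀ i j → x (toℕ {suc d} i) ≡ x (toℕ {suc d} j) → toℕ j ℕ.≤ toℕ i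
      x-≤ i j e = ≡.subst (toℕ j ℕ.≤_) (ℕₚ.+-identityʳ (toℕ i))
        (no-shortcut {k = 0} (Finₚ.toℕ≤pred[n] i) (Finₚ.toℕ≤pred[n] j)
        (≡.subst (λ v → Pos (I (x (toℕ i)) v)) e (pos-resp (≈-sym (I-diagonal (x (toℕ i)))) 1-pos)))
      x-injective : ∀ i j → x (toℕ {suc d} i) ≡ x (toℕ {suc d} j) → i ≡ j
      x-injective i j e = Finₚ.toℕ-injective (ℕₚ.≤-antisym (x-≤ j i (≡.sym e)) (x-≤ i j e))
      forward : ∀ (i j : Fin (suc d)) → ¬ (A (x (toℕ i)) (x (toℕ j)) ≈ 0#) → toℕ j ℕ.≤ suc (toℕ i)
      forward i j a≉0 = ≡.subst (toℕ j ℕ.≤_) (ℕₚ.+-comm (toℕ i) 1)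
        (no-shortcut (Finₚ.toℕ≤pred[n] i) (Finₚ.toℕ≤pred[n] j)
        (power-1 A≥0 (nonneg∧≉0⇒pos (A≥0 _ _) a≉0)))
      adjacent : ∀ i j → Γ A (x (toℕ i)) (x (toℕ j)) → ∣ toℕ i - toℕ j ∣ ≡ 1
      adjacent i j (xi≢xj , a≉0) = ∣-∣≡1-intro (xi≢xj ∘ ≡.cong x)
        (forward j i (symmetrizable-≉0 A symmetrizable _ _ a≉0)) (forward i j a≉0)
      step : ∀ (i j : Fin (suc d)) → toℕ j ≡ suc (toℕ i) → ¬ (A (x (toℕ i)) (x (toℕ j)) ≈ 0#)
      step i j j≡1+i = ≡.subst (λ k → ¬ (A (x (toℕ i)) (x k) ≈ 0#)) (≡.sym j≡1+i)
        (pos⇒≉0 (edges (toℕ i) (≡.subst (ℕ._≤ d) j≡1+i (Finₚ.toℕ≤pred[n] j))))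
      edge : ∀ i j → ∣ toℕ i - toℕ j ∣ ≡ 1 → Γ A (x (toℕ i)) (x (toℕ j))
      edge i j dist = (λ e → 0≢1
        (≡.trans (≡.sym (ℕₚ.m≡n⇒∣m-n∣≡0 (≡.cong toℕ (x-injective i j e)))) dist)) , nonzero
        (∣-∣≡1-elim dist)
        where
        0≢1 : 0 ≢ 1
        0≢1 ()
        nonzero : toℕ j ≡ suc (toℕ i) ⊎ toℕ i ≡ suc (toℕ j) → ¬ (A (x (toℕ i)) (x (toℕ j)) ≈ 0#)
        nonzero (inj₁ j≡1+i) = step i j j≡1+i
        nonzero (inj₂ i≡1+j) = symmetrizable-≉0 A symmetrizable _ _ (step j i i≡1+j)

  -- A step raises the position along the path by at most one, so position d needs at least d steps
  -- from position 0; always stepping to the next vertex achieves it.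
  path⇒powers : ∀ {d} {A : Mat (suc d)} → Nonnegative A → ∀ {s t} → IsBidirectedPath (Γ A) s t →
    (∀ k → k ℕ.< d → power A k s t ≈ 0#) × Pos (power A d s t)
  path⇒powers {d} {A} A≥0 {s} {t} (π , π₀≡s , πd≡t , path) =
    (λ k k<d → ≡.subst (λ u → power A k u t ≈ 0#) π₀≡s (short k zero k<d)) ,
    ≡.subst (λ u → Pos (power A d u t)) π₀≡s (reach d zero ≡.refl)
    where
    short : ∀ k i → toℕ i ℕ.+ k ℕ.< d → power A k (π ⟨$⟩ʳ i) t ≈ 0#
    short zero i i<d = I-off λ πi≡t → ℕₚ.<⇒≢ i<d (≡.trans (ℕₚ.+-identityʳ (toℕ i)) (≡.trans
      (≡.cong toℕ (≡.trans (≡.sym (inverseˡ π))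
        (≡.trans (≡.cong (π ⟨$⟩ˡ_) (≡.trans πi≡t (≡.sym πd≡t))) (inverseˡ π))))
      (Finₚ.toℕ-fromℕ d)))
    short (suc k) i i+1+k<d = sum-zero λ u →
      ≡.subst (λ v → A (π ⟨$⟩ʳ i) v * power A k v t ≈ 0#) (inverseʳ π) (term (π ⟨$⟩ˡ u))
      where
      1+i+k<d : suc (toℕ i) ℕ.+ k ℕ.< d
      1+i+k<d = ≡.subst (ℕ._< d) (ℕₚ.+-suc (toℕ i) k) i+1+k<d
      -- Diagonal entries may be nonzero though Γ has no loops, so a step may also stay in place.
      near : ∀ l → ¬ (A (π ⟨$⟩ʳ i) (π ⟨$⟩ʳ l) ≈ 0#) → toℕ l ℕ.≤ suc (toℕ i)
      near l a≉0 with (π ⟨$⟩ʳ i) Finₚ.≟ (π ⟨$⟩ʳ l)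
      ... | yes e = ℕₚ.m≤n⇒m≤1+n (ℕₚ.≤-reflexive (≡.cong toℕ
              (≡.trans (≡.sym (inverseˡ π)) (≡.trans (≡.cong (π ⟨$⟩ˡ_) (≡.sym e)) (inverseˡ π)))))
      ... | no πi≢πl with ∣-∣≡1-elim (Equivalence.to (path i l) (πi≢πl , a≉0))
      ...   | inj₁ l≡1+i = ℕₚ.≤-reflexive l≡1+i
      ...   | inj₂ i≡1+l = ℕₚ.≤-trans (ℕₚ.n≤1+n _)
        (ℕₚ.≤-trans (ℕₚ.≤-reflexive (≡.sym i≡1+l)) (ℕₚ.n≤1+n _))
      term : ∀ l → A (π ⟨$⟩ʳ i) (π ⟨$⟩ʳ l) * power A k (π ⟨$⟩ʳ l) t ≈ 0#
      term l with A (π ⟨$⟩ʳ i) (π ⟨$⟩ʳ l) ≟ 0#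
      ... | yes a≈0 = ≈-trans (*-congʳ a≈0) (zeroˡ _)
      ... | no  a≉0 = ≈-trans (*-congˡ
        (short k l (ℕₚ.≤-<-trans (ℕₚ.+-monoˡ-≤ k (near l a≉0)) 1+i+k<d))) (zeroʳ _)
    reach : ∀ k i → toℕ i ℕ.+ k ≡ d → Pos (power A k (π ⟨$⟩ʳ i) t)
    reach zero i i≡d = ≡.subst (λ u → Pos (I u t))
      (≡.trans (≡.sym πd≡t) (≡.cong (π ⟨$⟩ʳ_) (≡.sym i≡last)))
      (pos-resp (≈-sym (I-diagonal t)) 1-pos)
      where
      i≡last : i ≡ fromℕ d
      i≡last = Finₚ.toℕ-injective
        (≡.trans (≡.sym (ℕₚ.+-identityʳ (toℕ i))) (≡.trans i≡d (≡.sym (Finₚ.toℕ-fromℕ d))))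
    reach (suc k) i i+1+k≡d = power-cons A≥0 k
      (nonneg∧≉0⇒pos (A≥0 _ _) (proj₂
        (Equivalence.from (path i next) (∣-∣≡1-intro i≢next i≤ next≤))))
      (reach k next (≡.trans (≡.cong (ℕ._+ k) next≡) 1+i+k≡d))
      where
      1+i+k≡d : suc (toℕ i) ℕ.+ k ≡ d
      1+i+k≡d = ≡.trans (≡.sym (ℕₚ.+-suc (toℕ i) k)) i+1+k≡d
      1+i<1+d : suc (toℕ i) ℕ.< suc d
      1+i<1+d = s≤s (ℕₚ.≤-trans (ℕₚ.m≤m+n (suc (toℕ i)) k) (ℕₚ.≤-reflexive 1+i+k≡d))
      next : Fin (suc d)
      next = fromℕ< 1+i<1+d
      next≡ : toℕ next ≡ suc (toℕ i)
      next≡ = Finₚ.toℕ-fromℕ< 1+i<1+d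
      i≢next : toℕ i ≢ toℕ next
      i≢next e = ℕₚ.1+n≢n (≡.sym (≡.trans e next≡))
      i≤ : toℕ i ℕ.≤ suc (toℕ next)
      i≤ = ℕₚ.m≤n⇒m≤1+n (ℕₚ.≤-trans (ℕₚ.n≤1+n _) (ℕₚ.≤-reflexive (≡.sym next≡)))
      next≤ : toℕ next ℕ.≤ suc (toℕ i)
      next≤ = ℕₚ.≤-reflexive next≡

  path⇒diagonalization : ∀ {d} {A : Mat (suc d)} → Nonnegative A → ∀ {s t} → IsBidirectedPath
    (Γ A) s t →
    Symmetrizable A × Σ[ D ∈ Diagonalization A ] Diagonalization.Distinct D
  path⇒diagonalization {d} {A} A≥0 (π , _ , _ , path) = weights⇒symmetrizable weights ,
    eigensystem⇒diagonalization weights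
      (eigensystem-relabel π (resolvent⇒eigensystem (tridiagonal⇒resolvent tridiagonal)))
    where
    tridiagonal : Tridiagonal d (λ i j → A (π ⟨$⟩ʳ i) (π ⟨$⟩ʳ j))
    tridiagonal = path⇒tridiagonal d _ (λ i j → A≥0 _ _) λ i j → mk⇔
      (λ (i≢j , a≉0) → Equivalence.to (path i j)
        ((λ e → i≢j (≡.trans (≡.sym (inverseˡ π)) (≡.trans (≡.cong (π ⟨$⟩ˡ_) e) (inverseˡ π)))) ,
        a≉0))
      (λ dist → let (πi≢πj , a≉0) = Equivalence.from (path i j) dist in πi≢πj ∘ ≡.cong (π ⟨$⟩ʳ_) ,
                      a≉0)
    weights : ∃ (Weights A)
    weights = weights-relabel π (tridiagonal⇒weights tridiagonal)

theorem1p3 : (ℝ : CompleteOrderedField) →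
    let open CompleteOrderedField ℝ
        open LinearAlgebra ℝ
    in
    (d : ℕ) (A : Mat (suc d)) → Nonnegative A →
    (s t : Fin (suc d)) →
    IsBidirectedPath (Γ A) s t
      ⇔
    (Symmetrizable A × MultiplicityFree A ×
      ((θ : Vector Carrier (suc d)) → IsEigenvalueOrdering A θ →
       (E : Fin (suc d) → Mat (suc d)) → (∀ i → IsPrimitiveIdempotent A θ i (E i)) →
       ∃[ c ] ¬ (c ≈ 0#) × (∀ i → E i s t * differenceProduct θ i ≈ c)))
theorem1p3 ℝ d A A≥0 s t = mk⇔
  (λ path →
    let (symmetrizable , D , distinct) = path⇒diagonalization A≥0 path
        (short≈0 , d>0)                = path⇒powers A≥0 path
    in symmetrizable , Diagonalization.multiplicityFree D distinct , λ θ ordering E isPrimitive →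
       let moment≈power = λ k → ≈-sym (power-expansion D ordering E isPrimitive k s t)
       -- The common value is the moment of order d, which is the (s , t) entry of A ^ d.
       in power A d s t , pos⇒≉0 d>0 , moments-determine d θ (λ i → E i s t)
            (λ k k<d → ≈-trans (moment≈power k) (short≈0 k k<d)) (moment≈power d))
  (λ (symmetrizable , (diagonalizable , one-dimensional) , entries) →
    -- The hypothesis covers every ordering and every family of idempotents; it is applied to those
    -- of one diagonalization.
    let D        = diagonalizable⇒diagonalization diagonalizable
        distinct = multiplicityFree⇒distinct D one-dimensional
        ordering = distinct⇒ordering D distinct
        θ        = Diagonalization.value D
        isPrimitive = idempotent-isPrimitive D distinct
        (c , c≉0 , w∏≈c) = entries θ ordering (idempotent D) isPrimitive
        power≈moment = λ k → power-expansion D ordering (idempotent D) isPrimitive k s t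
        (lower , leading) = moments-vanish d θ (λ i → idempotent D i s t) distinct w∏≈c
    in powers⇒path A≥0 symmetrizable (λ k k<d → ≈-trans (power≈moment k) (lower k k<d))
         λ p≈0 → c≉0 (≈-trans (≈-sym leading) (≈-trans (≈-sym (power≈moment d)) p≈0)))
  where
  open OrderedField ℝ
  open Diagonalizations ℝ
  open PrimitiveIdempotents ℝ
  open Moments ℝ
  open Paths ℝ
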